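{- Let $u,v,w$ be words of length $N$ with $|u|_0=|v|_0=|w|_0=:N_0$ and $N_1:=N-N_0$. For every perfect matching $M$ of $G^N_o(u,w)$: $o_U(M)+o_D(M)+o_R(M)+o_L(M)=N(N-1)/2+N_1$, $\quad o_L(M)+o_D(M)=\mathrm{d}(w)-\mathrm{d}(u)$, $\quad o_U(M)+o_L(M)=N_0(N_0-1)/2+\mathrm{d}(w)$. For every perfect matching $M$ of $G^N_e(v,w)$: $e_U(M)+e_D(M)+e_R(M)+e_L(M)=N(N-1)/2+N_0$, $\quad e_L(M)+e_U(M)=\mathrm{d}(w)-\mathrm{d}(v)$, $\quad e_D(M)+e_L(M)=N_1(N_1-1)/2+\mathrm{d}(w)$.
   Context: Let $N\ge 1$. $G^N$ is the induced subgraph of the square lattice $\mathbb{Z}^2$ formed by $N$ consecutive, horizontally centred rows having $3,5,\dots,2N+1$ vertices from top to bottom. It is bipartite; vertices of the same colour as the leftmost vertex of each row are called odd, the others even. Let $B_1,\dots,B_N$ be the even vertices of the bottom row, $L_1,\dots,L_N$ the leftmost vertices of the rows, and $R_1,\dots,R_N$ the rightmost vertices of the rows, each family numbered from left to right (so $L_1$ is the leftmost vertex of the bottom row and $R_1$ the rightmost vertex of the top row). Words of length $N$ are $u=u_1\cdots u_N\in\{0,1\}^N$; $|u|_0,|u|_1$ count $0$s and $1$s; $\mathrm{d}(u)$ is the number of pairs $i<j$ with $u_i=1,u_j=0$. $G^N_o(u,w)$ is the induced subgraph of $G^N$ obtained by deleting all $R_i$, all $B_i$ with $w_i=0$, and all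 $L_i$ with $u_i=0$. $G^N_e(v,w)$ is the induced subgraph obtained by deleting all $L_i$, all $B_i$ with $w_i=1$, and all $R_i$ with $v_i=1$. For a perfect matching $M$ of $G^N_o(u,w)$, orient each edge from its odd endpoint to its even endpoint; $o_U(M),o_D(M),o_L(M),o_R(M)$ denote the numbers of edges pointing up, down, left, right respectively. For a perfect matching $M$ of $G^N_e(v,w)$, orient each edge from its even endpoint to its odd endpoint; $e_U(M),e_D(M),e_L(M),e_R(M)$ denote the numbers of edges pointing up, down, left, right. -}

module Defs where

open import Data.Bool.Base using (if_then_else_)
open import Data.Fin.Base using (Fin; toℕ)
open import Data.Fin.Patterns using (0F; 1F)
import Data.Fin.Properties as Fin
open import Data.Integer.Base using (ℤ; +_; -_; 1ℤ; -1ℤ; ∣_∣)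
import Data.Integer.Base as ℤ
import Data.Integer.Properties as ℤ
open import Data.List.Base using (List; length; filter; cartesianProduct; allFin)
open import Data.List.Membership.Propositional renaming (_∈_ to _∈ₗ_)
open import Data.List.Relation.Unary.All using (All)
open import Data.List.Relation.Unary.Unique.Propositional using (Unique)
open import Data.Nat.Base using (ℕ; suc; _+_; _*_; _∸_; _≤_; _<_)
open import Data.Nat.Divisibility using (_∣_; _∣?_)
open import Data.Product using (_×_; _,_; ∃-syntax; ∃!; proj₁; proj₂)
open import Data.Product.Properties using (≡-dec)
open import Data.Sum.Base using (_⊎_)
open import Data.Vec.Base using (Vec; lookup; count)
open import Level using (0ℓ)
open import Relation.Binary.PropositionalEquality using (_≡_; _≢_)
open import Relation.Nullary using (¬_; Dec; does)
open import Relation.Nullary.Decidable using (_×-dec_; ¬?)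
open import Relation.Unary using (Pred; Decidable; _∈_)

Word : ℕ → Set
Word N = Vec (Fin 2) N

∣_∣₀ : ∀ {N} → Word N → ℕ
∣ u ∣₀ = count (Fin._≟ 0F) u

Inversion : ∀ {N} → Word N → Pred (Fin N × Fin N) 0ℓ
Inversion u (i , j) = toℕ i < toℕ j × lookup u i ≡ 1F × lookup u j ≡ 0F

inversion? : ∀ {N} (u : Word N) → Decidable (Inversion u)
inversion? u (i , j) =
  (i Fin.<? j) ×-dec (lookup u i Fin.≟ 1F) ×-dec (lookup u j Fin.≟ 0F)

d : ∀ {N} → Word N → ℕ
d {N} u = length (filter (inversion? u) (cartesianProduct (allFin N) (allFin N)))

-- The square lattice: the first coordinate grows to the right, the second upwards.
Point : Set
Point = ℤ × ℤ

_≟ₚ_ : (p q : Point) → Dec (p ≡ q)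
_≟ₚ_ = ≡-dec ℤ._≟_ ℤ._≟_

data Direction : Set where
  up down left right : Direction

step : Direction → Point → Point
step up    (x , y) = x , y ℤ.+ 1ℤ
step down  (x , y) = x , y ℤ.+ -1ℤ
step left  (x , y) = x ℤ.+ -1ℤ , y
step right (x , y) = x ℤ.+ 1ℤ , y

-- Every undirected edge of the lattice is represented exactly once, by its
-- left endpoint if it is horizontal and by its lower endpoint if it is vertical.
data Edge : Set where
  horizontal vertical : Point → Edge

endpoints : Edge → Point × Point
endpoints (horizontal p) = p , step right p
endpoints (vertical   p) = p , step up p

Incident : Point → Edge → Set
Incident p e = p ≡ proj₁ (endpoints e) ⊎ p ≡ proj₂ (endpoints e)

-- An induced subgraph of the square lattice is given by its set of vertices.
InducedSubgraph : Set₁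
InducedSubgraph = Pred Point 0ℓ

EdgeOf : InducedSubgraph → Pred Edge 0ℓ
EdgeOf V e = proj₁ (endpoints e) ∈ V × proj₂ (endpoints e) ∈ V

-- The finite set of edges of a matching is a list without repetitions.
record PerfectMatching (V : InducedSubgraph) : Set where
  field
    edges    : List Edge
    unique   : Unique edges
    subgraph : All (EdgeOf V) edges
    perfect  : ∀ p → p ∈ V → ∃! _≡_ λ e → e ∈ₗ edges × Incident p e

-- Row i (from the top, 1 ≤ i ≤ N) consists of the 2i + 1 points (x , - i) with
-- - i ≤ x ≤ i.
G : ℕ → InducedSubgraph
G N (x , y) = ∃[ i ] 1 ≤ i × i ≤ N × y ≡ - (+ i) × ∣ x ∣ ≤ i

-- The leftmost vertex of row i is (- i , - i), so its colour class consists of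
-- the points whose coordinates have an even sum. These are the vertices called odd.
OddVertex : Pred Point 0ℓ
OddVertex (x , y) = 2 ∣ ∣ x ℤ.+ y ∣

oddVertex? : Decidable OddVertex
oddVertex? (x , y) = 2 ∣? ∣ x ℤ.+ y ∣

EvenVertex : Pred Point 0ℓ
EvenVertex p = ¬ OddVertex p

evenVertex? : Decidable EvenVertex
evenVertex? p = ¬? (oddVertex? p)

-- Indices start at 0 here: L N j, R N j and B N j are the usual L_{j+1}, R_{j+1}
-- and B_{j+1}. Numbering from left to right, L_{j+1} lies in row N - j and
-- R_{j+1} in row j + 1, while the even vertices of the bottom row are those with
-- first coordinate - N + 1, - N + 3, …, N - 1.
L R B : (N : ℕ) → Fin N → Point
L N j = - (+ (N ∸ toℕ j)) , - (+ (N ∸ toℕ j))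
R N j = + suc (toℕ j) , - (+ suc (toℕ j))
B N j = - (+ N) ℤ.+ + (1 + 2 * toℕ j) , - (+ N)

Gₒ : ∀ {N} (u w : Word N) → InducedSubgraph
Gₒ {N} u w p =
    p ∈ G N
  × (∀ i → p ≢ R N i)
  × (∀ i → lookup w i ≡ 0F → p ≢ B N i)
  × (∀ i → lookup u i ≡ 0F → p ≢ L N i)

Gₑ : ∀ {N} (v w : Word N) → InducedSubgraph
Gₑ {N} v w p =
    p ∈ G N
  × (∀ i → p ≢ L N i)
  × (∀ i → lookup w i ≡ 1F → p ≢ B N i)
  × (∀ i → lookup v i ≡ 1F → p ≢ R N i)

-- The edge as a pair (tail , head), where the tail is the endpoint satisfying P.
-- It is used only for the two colour classes, of which every edge meets each once.
orient : {P : Pred Point 0ℓ} → Decidable P → Edge → Point × Point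
orient P? e with endpoints e
... | a , b = if does (P? a) then (a , b) else (b , a)

Points : Direction → Pred (Point × Point) 0ℓ
Points δ (s , t) = t ≡ step δ s

points? : ∀ δ → Decidable (Points δ)
points? δ (s , t) = t ≟ₚ step δ s

numberPointing : {P : Pred Point 0ℓ} → Decidable P → Direction →
                 ∀ {V} → PerfectMatching V → ℕ
numberPointing P? δ M =
  length (filter (λ e → points? δ (orient P? e)) (PerfectMatching.edges M))

oU oD oL oR eU eD eL eR : ∀ {V} → PerfectMatching V → ℕ
oU = numberPointing oddVertex? up
oD = numberPointing oddVertex? down
oL = numberPointing oddVertex? left
oR = numberPointing oddVertex? right
eU = numberPointing evenVertex? up
eD = numberPointing evenVertex? down
eL = numberPointing evenVertex? left
eR = numberPointing evenVertex? right

{-# OPTIONS --safe #-}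
-- Along an edge x + y and x − y change by ±1, and each sign singles out two of
-- the four directions. Summing over a perfect matching, 2 #{left or down} is the
-- number of edges plus Σ (x + y) over the tails minus Σ (x + y) over the heads,
-- and x − y gives #{up or left} in the same way; these sums run over the colour
-- classes, so they do not depend on the matching. The inner odd vertices are the
-- even vertices of the upper N − 1 rows moved down by one, so their contributions
-- cancel up to N (N − 1) / 2. What remains are sums of the positions of a letter in
-- a word, and the positions of the 0s add up to N₀ (N₀ − 1) / 2 + d.
module Submission where

open import Defs
open import Data.Bool.Base using (true; false; if_then_else_)
open import Data.Empty using (⊥)
open import Data.Fin.Base as Fin using (Fin; zero; suc; toℕ; fromℕ<)
open import Data.Fin.Patterns using (0F; 1F)
import Data.Fin.Properties as Fin
open import Data.Integer using (ℤ; +_; -_; _-_; _⊖_; -[1+_]; ∣_∣; 0ℤ; 1ℤ; -1ℤ)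
import Data.Integer.Base as ℤ
import Data.Integer.Properties as ℤ
import Data.Integer.Tactic.RingSolver as ℤ-Ring
open import Algebra.Properties.AbelianGroup ℤ.+-0-abelianGroup using ()
  renaming (∙-cancelˡ to +ᶻ-cancelˡ; ∙-cancelʳ to +ᶻ-cancelʳ)
open import Data.List.Base
  using (List; []; _∷_; _++_; map; length; filter; upTo; tabulate; allFin; cartesianProduct)
open import Data.List.Membership.Propositional renaming (_∈_ to _∈ₗ_)
open import Data.List.Membership.Propositional.Properties
  using (∈-map⁺; ∈-map⁻; ∈-++⁺ˡ; ∈-++⁺ʳ; ∈-++⁻; ∈-upTo⁺; ∈-upTo⁻; ∈-filter⁺; ∈-filter⁻; ∈-allFin)
open import Data.List.Membership.Propositional.Properties.WithK using (unique∧set⇒bag)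
open import Data.List.Properties
  using (length-map; length-++; length-upTo; map-tabulate;
         filter-≐; filter-++; filter-none; filter-accept; filter-reject)
open import Data.List.Relation.Binary.BagAndSetEquality using (∼bag⇒↭)
open import Data.List.Relation.Binary.Permutation.Propositional as ↭ using (_↭_)
open import Data.List.Relation.Binary.Permutation.Propositional.Properties using (↭-length)
open import Data.List.Relation.Unary.All as All using (All)
import Data.List.Relation.Unary.All.Properties as All
open import Data.List.Relation.Unary.AllPairs using ([]; _∷_)
open import Data.List.Relation.Unary.Any using (here; there)
open import Data.List.Relation.Unary.Unique.Propositional using (Unique)
import Data.List.Relation.Unary.Unique.Propositional.Properties as Unique
open import Data.Nat
  using (ℕ; suc; _+_; _*_; _∸_; _/_; _≤_; _<_; z≤n; s≤s; s≤s⁻¹; z<s; s<s; s<s⁻¹)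
open import Data.Nat.Divisibility using (_∣_; _∣?_; divides; ∣m+n∣m⇒∣n; m∣m*n; ∣1⇒≡1)
open import Data.Nat.DivMod using (m*n/n≡m; /-congˡ)
import Data.Nat.Properties as ℕ
import Data.Nat.Tactic.RingSolver as ℕ-Ring
open import Data.Product using (_×_; _,_; proj₁; proj₂; ∃-syntax; map₁)
open import Data.Product.Properties using (,-injectiveˡ; ,-injectiveʳ)
open import Data.Sum.Base as Sum using (_⊎_; inj₁; inj₂; swap)
open import Data.Vec.Base using (lookup) renaming ([] to []ᵛ; _∷_ to _∷ᵛ_)
open import Function.Base using (_∘_; id)
open import Function.Bundles using (mk⇔)
open import Level using (0ℓ)
open import Relation.Binary.PropositionalEquality
  using (_≡_; _≢_; refl; sym; trans; cong; cong₂; subst; module ≡-Reasoning)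
open import Relation.Nullary using (¬_; Dec; yes; no; does; contradiction)
open import Relation.Nullary.Decidable using (¬?; decidable-stable)
open import Relation.Unary using (Pred; Decidable; _∈_; _≐_)

-- Edges counted by direction

-- A subgraph is a bare predicate while a matching is a list of edges, so a sum over tails or heads
-- becomes a sum over a colour class only after that class has been listed without repetitions and
-- the endpoints of the edges have been shown to be a permutation of the list. The coordinates of
-- `oddPt` and `evenPt` make the listing possible: the inner vertices of both colours are indexed by
-- one and the same triangle of pairs, so the sum over it never has to be evaluated. The number of
-- edges is the number of tails: `tri N` plus the surviving boundary vertices of that colour. On
-- `L`, `R` and `B` both functionals are affine in the index, with `x + y` zero on `R` and `x - y`
-- zero on `L`. In each graph, therefore, one of the two identities loses the side word and involves
-- `w` alone, while in the other the side word and `w` enter with the same slope and opposite signs.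
-- `Gₒ` retains boundary vertices at the letter 1, whose positions are the complement of those of
-- the 0s; `Gₑ` retains them at the letter 0.

∑ : {A : Set} → (A → ℤ) → List A → ℤ
∑ f []       = 0ℤ
∑ f (x ∷ xs) = f x ℤ.+ ∑ f xs

∑-cong : {A : Set} {f g : A → ℤ} → (∀ x → f x ≡ g x) → ∀ xs → ∑ f xs ≡ ∑ g xs
∑-cong f≗g []       = refl
∑-cong f≗g (x ∷ xs) = cong₂ ℤ._+_ (f≗g x) (∑-cong f≗g xs)

∑-map : {A B : Set} (f : B → ℤ) (g : A → B) (xs : List A) → ∑ f (map g xs) ≡ ∑ (f ∘ g) xs
∑-map f g []       = refl
∑-map f g (x ∷ xs) = cong (λ s → f (g x) ℤ.+ s) (∑-map f g xs)

∑-++ : {A : Set} (f : A → ℤ) (xs ys : List A) → ∑ f (xs ++ ys) ≡ ∑ f xs ℤ.+ ∑ f ys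
∑-++ f []       ys = sym (ℤ.+-identityˡ _)
∑-++ f (x ∷ xs) ys =
  trans (cong (λ s → f x ℤ.+ s) (∑-++ f xs ys)) (sym (ℤ.+-assoc (f x) (∑ f xs) (∑ f ys)))

∑-↭ : {A : Set} (f : A → ℤ) {xs ys : List A} → xs ↭ ys → ∑ f xs ≡ ∑ f ys
∑-↭ f ↭.refl         = refl
∑-↭ f (↭.prep x p)   = cong (λ s → f x ℤ.+ s) (∑-↭ f p)
∑-↭ f (↭.trans p q)  = trans (∑-↭ f p) (∑-↭ f q)
∑-↭ f {_ ∷ _ ∷ xs} {_ ∷ _ ∷ ys} (↭.swap x y p) = begin
  f x ℤ.+ (f y ℤ.+ ∑ f xs)  ≡⟨ exchange (f x) (f y) (∑ f xs) ⟩
  f y ℤ.+ (f x ℤ.+ ∑ f xs)  ≡⟨ cong (λ s → f y ℤ.+ (f x ℤ.+ s)) (∑-↭ f p) ⟩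
  f y ℤ.+ (f x ℤ.+ ∑ f ys)  ∎
  where
  open ≡-Reasoning
  exchange : ∀ a b c → a ℤ.+ (b ℤ.+ c) ≡ b ℤ.+ (a ℤ.+ c)
  exchange = ℤ-Ring.solve-∀

∑-affine : {A : Set} {f g : A → ℤ} (k c : ℤ) → (∀ x → g x ≡ k ℤ.* f x ℤ.+ c) →
           ∀ xs → ∑ g xs ≡ k ℤ.* ∑ f xs ℤ.+ + length xs ℤ.* c
∑-affine k c g≡ []       = base k c
  where
  base : ∀ k c → 0ℤ ≡ k ℤ.* 0ℤ ℤ.+ 0ℤ ℤ.* c
  base = ℤ-Ring.solve-∀
∑-affine {f = f} k c g≡ (x ∷ xs) = trans
  (cong₂ ℤ._+_ (g≡ x) (∑-affine k c g≡ xs))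
  (rearrange k c (f x) (∑ f xs) (+ length xs))
  where
  rearrange : ∀ k c a s l → (k ℤ.* a ℤ.+ c) ℤ.+ (k ℤ.* s ℤ.+ l ℤ.* c) ≡
                            k ℤ.* (a ℤ.+ s) ℤ.+ (1ℤ ℤ.+ l) ℤ.* c
  rearrange = ℤ-Ring.solve-∀

_≟ᵈ_ : (δ ε : Direction) → Dec (δ ≡ ε)
up    ≟ᵈ up    = yes refl
up    ≟ᵈ down  = no λ ()
up    ≟ᵈ left  = no λ ()
up    ≟ᵈ right = no λ ()
down  ≟ᵈ up    = no λ ()
down  ≟ᵈ down  = yes refl
down  ≟ᵈ left  = no λ ()
down  ≟ᵈ right = no λ ()
left  ≟ᵈ up    = no λ ()
left  ≟ᵈ down  = no λ ()
left  ≟ᵈ left  = yes refl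
left  ≟ᵈ right = no λ ()
right ≟ᵈ up    = no λ ()
right ≟ᵈ down  = no λ ()
right ≟ᵈ left  = no λ ()
right ≟ᵈ right = yes refl

diag antidiag : Point → ℤ
diag     (x , y) = x ℤ.+ y
antidiag (x , y) = x - y

𝟙 : Direction → Direction → ℤ
𝟙 δ ε = if does (ε ≟ᵈ δ) then 1ℤ else 0ℤ

-- The sign is written as 1 minus twice an indicator so that a sum over edges becomes the number of
-- edges minus twice a count of directions.
diagStep antidiagStep : Direction → ℤ
diagStep     δ = 1ℤ - + 2 ℤ.* (𝟙 left δ ℤ.+ 𝟙 down δ)
antidiagStep δ = 1ℤ - + 2 ℤ.* (𝟙 up δ ℤ.+ 𝟙 left δ)

private
  diag₁ : ∀ x y c → x ℤ.+ c ℤ.+ y ≡ x ℤ.+ y ℤ.+ c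
  diag₁ = ℤ-Ring.solve-∀
  diag₂ : ∀ x y c → x ℤ.+ (y ℤ.+ c) ≡ x ℤ.+ y ℤ.+ c
  diag₂ = ℤ-Ring.solve-∀
  antidiag₁ : ∀ x y c → x ℤ.+ c - y ≡ x - y ℤ.+ c
  antidiag₁ = ℤ-Ring.solve-∀
  antidiag₂ : ∀ x y c → x - (y ℤ.+ c) ≡ x - y ℤ.+ - c
  antidiag₂ = ℤ-Ring.solve-∀

diag-step : ∀ δ p → diag (step δ p) ≡ diag p ℤ.+ diagStep δ
diag-step up    (x , y) = diag₂ x y 1ℤ
diag-step down  (x , y) = diag₂ x y -1ℤ
diag-step left  (x , y) = diag₁ x y -1ℤ
diag-step right (x , y) = diag₁ x y 1ℤ

antidiag-step : ∀ δ p → antidiag (step δ p) ≡ antidiag p ℤ.+ antidiagStep δ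
antidiag-step up    (x , y) = antidiag₂ x y 1ℤ
antidiag-step down  (x , y) = antidiag₂ x y -1ℤ
antidiag-step left  (x , y) = antidiag₁ x y -1ℤ
antidiag-step right (x , y) = antidiag₁ x y 1ℤ

-- The two signs together distinguish all four directions; in each mixed case one of the two sign
-- equations is absurd.
step-injective : ∀ {δ ε} p → step δ p ≡ step ε p → δ ≡ ε
step-injective {δ} {ε} p eq = injective δ ε
  (+ᶻ-cancelˡ (diag p) _ _
    (trans (sym (diag-step δ p)) (trans (cong diag eq) (diag-step ε p))))
  (+ᶻ-cancelˡ (antidiag p) _ _
    (trans (sym (antidiag-step δ p)) (trans (cong antidiag eq) (antidiag-step ε p))))
  where
  injective : ∀ δ ε → diagStep δ ≡ diagStep ε → antidiagStep δ ≡ antidiagStep ε → δ ≡ ε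
  injective up    up    _ _ = refl
  injective down  down  _ _ = refl
  injective left  left  _ _ = refl
  injective right right _ _ = refl
  injective up down () _
  injective up left () _
  injective up right _ ()
  injective down up () _
  injective down left _ ()
  injective down right () _
  injective left up () _
  injective left down _ ()
  injective left right () _
  injective right up _ ()
  injective right down () _
  injective right left () _

step-left-right : ∀ p → p ≡ step left (step right p)
step-left-right (x , y) = cong (_, y) (cancel x)
  where
  cancel : ∀ x → x ≡ x ℤ.+ 1ℤ ℤ.+ -1ℤ
  cancel = ℤ-Ring.solve-∀

step-down-up : ∀ p → p ≡ step down (step up p)
step-down-up (x , y) = cong (x ,_) (cancel y)
  where
  cancel : ∀ x → x ≡ x ℤ.+ 1ℤ ℤ.+ -1ℤ
  cancel = ℤ-Ring.solve-∀

module _ {A : Set} (direction : A → Direction) (tail : A → Point) where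

  arrowHead : A → Point
  arrowHead x = step (direction x) (tail x)

  # : Direction → List A → ℕ
  # δ xs = length (filter (λ x → direction x ≟ᵈ δ) xs)

  #≡∑ : ∀ δ xs → + # δ xs ≡ ∑ (𝟙 δ ∘ direction) xs
  #≡∑ δ [] = refl
  #≡∑ δ (x ∷ xs) with does (direction x ≟ᵈ δ)
  ... | true  = cong (λ s → 1ℤ ℤ.+ s) (#≡∑ δ xs)
  ... | false = trans (#≡∑ δ xs) (sym (ℤ.+-identityˡ _))

  #-total : ∀ xs → # up xs + # down xs + # right xs + # left xs ≡ length xs
  #-total xs = ℤ.+-injective (begin
    + # up xs ℤ.+ + # down xs ℤ.+ + # right xs ℤ.+ + # left xs
      ≡⟨ cong₂ ℤ._+_ (cong₂ ℤ._+_ (cong₂ ℤ._+_ (#≡∑ up xs) (#≡∑ down xs)) (#≡∑ right xs))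
                     (#≡∑ left xs) ⟩
    ∑𝟙 up xs ℤ.+ ∑𝟙 down xs ℤ.+ ∑𝟙 right xs ℤ.+ ∑𝟙 left xs
      ≡⟨ one-each xs ⟩
    + length xs ∎)
    where
    open ≡-Reasoning
    ∑𝟙 : Direction → List A → ℤ
    ∑𝟙 δ = ∑ (𝟙 δ ∘ direction)
    one : ∀ δ → 𝟙 up δ ℤ.+ 𝟙 down δ ℤ.+ 𝟙 right δ ℤ.+ 𝟙 left δ ≡ 1ℤ
    one up    = refl
    one down  = refl
    one left  = refl
    one right = refl
    regroup : ∀ a b c e u v r l → (a ℤ.+ u) ℤ.+ (b ℤ.+ v) ℤ.+ (c ℤ.+ r) ℤ.+ (e ℤ.+ l) ≡
                                  (a ℤ.+ b ℤ.+ c ℤ.+ e) ℤ.+ (u ℤ.+ v ℤ.+ r ℤ.+ l)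
    regroup = ℤ-Ring.solve-∀
    one-each : ∀ xs → ∑𝟙 up xs ℤ.+ ∑𝟙 down xs ℤ.+ ∑𝟙 right xs ℤ.+ ∑𝟙 left xs ≡ + length xs
    one-each [] = refl
    one-each (x ∷ xs) = trans
      (regroup (𝟙 up (direction x)) (𝟙 down (direction x)) (𝟙 right (direction x)) (𝟙 left (direction x))
               (∑𝟙 up xs) (∑𝟙 down xs) (∑𝟙 right xs) (∑𝟙 left xs))
      (cong₂ ℤ._+_ (one (direction x)) (one-each xs))

  #-pair : (φ : Point → ℤ) (α β : Direction) →
           (∀ δ p → φ (step δ p) ≡ φ p ℤ.+ (1ℤ - + 2 ℤ.* (𝟙 α δ ℤ.+ 𝟙 β δ))) →
           ∀ xs → + 2 ℤ.* + (# α xs + # β xs) ℤ.+ ∑ (φ ∘ arrowHead) xs ≡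
                  + length xs ℤ.+ ∑ (φ ∘ tail) xs
  #-pair φ α β φ-step xs = trans
    (cong₂ (λ a b → + 2 ℤ.* (a ℤ.+ b) ℤ.+ ∑ (φ ∘ arrowHead) xs) (#≡∑ α xs) (#≡∑ β xs)) (telescope xs)
    where
    regroup : ∀ a b t u v s →
      + 2 ℤ.* (a ℤ.+ u ℤ.+ (b ℤ.+ v)) ℤ.+ (t ℤ.+ (1ℤ - + 2 ℤ.* (a ℤ.+ b)) ℤ.+ s) ≡
      (1ℤ ℤ.+ t) ℤ.+ (+ 2 ℤ.* (u ℤ.+ v) ℤ.+ s)
    regroup = ℤ-Ring.solve-∀
    exchange : ∀ t l s → (1ℤ ℤ.+ t) ℤ.+ (l ℤ.+ s) ≡ (1ℤ ℤ.+ l) ℤ.+ (t ℤ.+ s)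
    exchange = ℤ-Ring.solve-∀
    -- Each edge adds 1 + φ(tail) to both sides: φ(head) falls short of it by 2 exactly when the
    -- direction is `α` or `β`, and then the count supplies the missing 2. For this, `α` and `β`
    -- must be distinct only in so far as `φ-step` already forces it.
    telescope : ∀ xs →
      + 2 ℤ.* (∑ (𝟙 α ∘ direction) xs ℤ.+ ∑ (𝟙 β ∘ direction) xs) ℤ.+ ∑ (φ ∘ arrowHead) xs ≡
      + length xs ℤ.+ ∑ (φ ∘ tail) xs
    telescope [] = refl
    telescope (x ∷ xs) = begin
      _ ≡⟨ cong (λ h → + 2 ℤ.* (𝟙 α δ ℤ.+ u ℤ.+ (𝟙 β δ ℤ.+ v)) ℤ.+ (h ℤ.+ s)) (φ-step δ (tail x)) ⟩
      _ ≡⟨ regroup (𝟙 α δ) (𝟙 β δ) (φ (tail x)) u v s ⟩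
      _ ≡⟨ cong (λ z → (1ℤ ℤ.+ φ (tail x)) ℤ.+ z) (telescope xs) ⟩
      _ ≡⟨ exchange (φ (tail x)) (+ length xs) (∑ (φ ∘ tail) xs) ⟩
      _ ∎
      where
      open ≡-Reasoning
      δ = direction x
      u = ∑ (𝟙 α ∘ direction) xs
      v = ∑ (𝟙 β ∘ direction) xs
      s = ∑ (φ ∘ arrowHead) xs

module _ {P : Pred Point 0ℓ} (P? : Decidable P) where

  edgeDirection : Edge → Direction
  edgeDirection (horizontal p) = if does (P? p) then right else left
  edgeDirection (vertical p)   = if does (P? p) then up else down

  edgeTail : Edge → Point
  edgeTail e = proj₁ (orient P? e)

  orient-step : ∀ e → Points (edgeDirection e) (orient P? e)
  orient-step (horizontal p) with does (P? p)
  ... | true  = refl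
  ... | false = step-left-right p
  orient-step (vertical p) with does (P? p)
  ... | true  = refl
  ... | false = step-down-up p

  -- A given tail and head are joined by at most one direction, so testing whether the edge points
  -- along `δ` is the same as comparing `δ` with the computed direction.
  numberPointing≡# : ∀ δ {V} (M : PerfectMatching V) →
    numberPointing P? δ M ≡ # edgeDirection edgeTail δ (PerfectMatching.edges M)
  numberPointing≡# δ M = cong length
    (filter-≐ _ _ ((λ {e} → to e) , (λ {e} → from e)) (PerfectMatching.edges M))
    where
    to : ∀ e → Points δ (orient P? e) → edgeDirection e ≡ δ
    to e eq = step-injective (edgeTail e) (trans (sym (orient-step e)) eq)
    from : ∀ e → edgeDirection e ≡ δ → Points δ (orient P? e)
    from e refl = orient-step e

-- Edges of a perfect matching against the vertices of one colour

unique-map : {A B : Set} (f : A → B) (xs : List A) →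
             (∀ {x y} → x ∈ₗ xs → y ∈ₗ xs → f x ≡ f y → x ≡ y) →
             Unique xs → Unique (map f xs)
unique-map f []       inj []         = []
unique-map f (x ∷ xs) inj (x∉ ∷ xs!) =
  All.map⁺ (All.tabulate λ y∈ fx≡fy → All.lookup x∉ y∈ (inj (here refl) (there y∈) fx≡fy))
  ∷ unique-map f xs (λ x∈ y∈ → inj (there x∈) (there y∈)) xs!

-- `unique` makes `X` correct as a multiset and not only as a set, which is what sums and lengths
-- require.
record Enumeration (V : InducedSubgraph) (Q : Pred Point 0ℓ) (X : List Point) : Set where
  field
    unique   : Unique X
    sound    : ∀ {p} → p ∈ₗ X → p ∈ V × Q p
    complete : ∀ {p} → p ∈ V → Q p → p ∈ₗ X

module _ {V : InducedSubgraph} (M : PerfectMatching V) (f : Edge → Point) (Q : Pred Point 0ℓ)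
         (f-incident : ∀ e → Incident (f e) e) (Q-f : ∀ e → Q (f e))
         (f-unique : ∀ {p} e → Incident p e → Q p → p ≡ f e) where
  open PerfectMatching M

  endpoint∈V : ∀ {e p} → e ∈ₗ edges → Incident p e → p ∈ V
  endpoint∈V e∈ (inj₁ refl) = proj₁ (All.lookup subgraph e∈)
  endpoint∈V e∈ (inj₂ refl) = proj₂ (All.lookup subgraph e∈)

  -- Every edge has exactly one endpoint in `Q`, and every vertex of `V` lies on exactly one edge,
  -- so `f` is a bijection from the edges to the vertices in `Q`. Two lists without repetitions that
  -- have the same members are permutations of each other.
  endpoint-↭ : ∀ {X} → Enumeration V Q X → map f edges ↭ X
  endpoint-↭ {X} enum = ∼bag⇒↭ (unique∧set⇒bag
    (unique-map f edges injective unique) E.unique (mk⇔ to from))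
    where
    module E = Enumeration enum
    injective : ∀ {e e′} → e ∈ₗ edges → e′ ∈ₗ edges → f e ≡ f e′ → e ≡ e′
    injective {e} {e′} e∈ e′∈ fe≡fe′ =
      let (_ , _ , unique!) = perfect (f e) (endpoint∈V e∈ (f-incident e))
      in trans (sym (unique! (e∈ , f-incident e)))
               (unique! (e′∈ , subst (λ p → Incident p e′) (sym fe≡fe′) (f-incident e′)))
    to : ∀ {p} → p ∈ₗ map f edges → p ∈ₗ X
    to p∈ with e , e∈ , refl ← ∈-map⁻ f p∈ = E.complete (endpoint∈V e∈ (f-incident e)) (Q-f e)
    from : ∀ {p} → p ∈ₗ X → p ∈ₗ map f edges
    from {p} p∈ with p∈V , Qp ← E.sound p∈ with e , (e∈ , inc) , _ ← perfect p p∈V =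
      subst (_∈ₗ map f edges) (sym (f-unique e inc Qp)) (∈-map⁺ f e∈)

-- The class stays abstract so that one argument serves both orientations, from odd to even and from
-- even to odd.
Bipartite : Pred Point 0ℓ → Set
Bipartite P = ∀ e → let (a , b) = endpoints e in (P a × ¬ P b) ⊎ (¬ P a × P b)

module _ {P : Pred Point 0ℓ} (P? : Decidable P) (bipartite : Bipartite P) where

  private
    edgeHead : Edge → Point
    edgeHead e = proj₂ (orient P? e)

    tail-incident : ∀ e → Incident (edgeTail P? e) e
    tail-incident e with does (P? (proj₁ (endpoints e)))
    ... | true  = inj₁ refl
    ... | false = inj₂ refl

    head-incident : ∀ e → Incident (edgeHead e) e
    head-incident e with does (P? (proj₁ (endpoints e)))
    ... | true  = inj₂ refl
    ... | false = inj₁ refl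

    P-tail : ∀ e → P (edgeTail P? e)
    P-tail e with P? (proj₁ (endpoints e)) | bipartite e
    ... | yes Pa | _               = Pa
    ... | no ¬Pa | inj₁ (Pa , _)   = contradiction Pa ¬Pa
    ... | no ¬Pa | inj₂ (_ , Pb)   = Pb

    ¬P-head : ∀ e → ¬ P (edgeHead e)
    ¬P-head e with P? (proj₁ (endpoints e)) | bipartite e
    ... | yes Pa | inj₁ (_ , ¬Pb)  = ¬Pb
    ... | yes Pa | inj₂ (¬Pa , _)  = contradiction Pa ¬Pa
    ... | no ¬Pa | _               = ¬Pa

    tail-unique : ∀ {p} e → Incident p e → P p → p ≡ edgeTail P? e
    tail-unique e inc Pp with P? (proj₁ (endpoints e)) | bipartite e
    tail-unique e (inj₁ refl) Pp | yes _  | _              = refl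
    tail-unique e (inj₁ refl) Pp | no ¬Pa | _              = contradiction Pp ¬Pa
    tail-unique e (inj₂ refl) Pp | yes Pa | inj₁ (_ , ¬Pb) = contradiction Pp ¬Pb
    tail-unique e (inj₂ refl) Pp | yes Pa | inj₂ (¬Pa , _) = contradiction Pa ¬Pa
    tail-unique e (inj₂ refl) Pp | no _   | _              = refl

    head-unique : ∀ {p} e → Incident p e → ¬ P p → p ≡ edgeHead e
    head-unique e inc ¬Pp with P? (proj₁ (endpoints e)) | bipartite e
    head-unique e (inj₁ refl) ¬Pp | yes Pa | _              = contradiction Pa ¬Pp
    head-unique e (inj₁ refl) ¬Pp | no _   | _              = refl
    head-unique e (inj₂ refl) ¬Pp | yes _  | _              = refl
    head-unique e (inj₂ refl) ¬Pp | no ¬Pa | inj₁ (Pa , _)  = contradiction Pa ¬Pa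
    head-unique e (inj₂ refl) ¬Pp | no ¬Pa | inj₂ (_ , Pb)  = contradiction Pb ¬Pp

  module _ {V : InducedSubgraph} (M : PerfectMatching V) {X Y : List Point}
           (tails : Enumeration V P X) (heads : Enumeration V (¬_ ∘ P) Y) where
    open PerfectMatching M using (edges)

    private
      tails↭ : map (edgeTail P?) edges ↭ X
      tails↭ = endpoint-↭ M (edgeTail P?) P tail-incident P-tail tail-unique tails

      heads↭ : map edgeHead edges ↭ Y
      heads↭ = endpoint-↭ M edgeHead (¬_ ∘ P) head-incident ¬P-head head-unique heads

      n : Direction → ℕ
      n δ = numberPointing P? δ M

      ♯ : Direction → ℕ
      ♯ δ = # (edgeDirection P?) (edgeTail P?) δ edges

      length-edges : length edges ≡ length X
      length-edges = trans (sym (length-map (edgeTail P?) edges)) (↭-length tails↭)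

    numberPointing-total : n up + n down + n right + n left ≡ length X
    numberPointing-total = begin
      n up + n down + n right + n left
        ≡⟨ cong₂ _+_ (cong₂ _+_ (cong₂ _+_ (eq up) (eq down)) (eq right)) (eq left) ⟩
      ♯ up + ♯ down + ♯ right + ♯ left
        ≡⟨ #-total (edgeDirection P?) (edgeTail P?) edges ⟩
      length edges
        ≡⟨ length-edges ⟩
      length X ∎
      where
      open ≡-Reasoning
      eq = λ δ → numberPointing≡# P? δ M

    numberPointing-pair : (φ : Point → ℤ) (α β : Direction) →
      (∀ δ p → φ (step δ p) ≡ φ p ℤ.+ (1ℤ - + 2 ℤ.* (𝟙 α δ ℤ.+ 𝟙 β δ))) →
      + 2 ℤ.* + (n α + n β) ℤ.+ ∑ φ Y ≡ + length X ℤ.+ ∑ φ X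
    numberPointing-pair φ α β φ-step = begin
      + 2 ℤ.* + (n α + n β) ℤ.+ ∑ φ Y
        ≡⟨ cong₂ (λ k s → + 2 ℤ.* + k ℤ.+ s)
             (cong₂ _+_ (numberPointing≡# P? α M) (numberPointing≡# P? β M)) ∑Y ⟩
      + 2 ℤ.* + (♯ α + ♯ β) ℤ.+ ∑ (φ ∘ arrowHead (edgeDirection P?) (edgeTail P?)) edges
        ≡⟨ #-pair (edgeDirection P?) (edgeTail P?) φ α β φ-step edges ⟩
      + length edges ℤ.+ ∑ (φ ∘ edgeTail P?) edges
        ≡⟨ cong₂ (λ k s → + k ℤ.+ s) length-edges
             (trans (sym (∑-map φ (edgeTail P?) edges)) (∑-↭ φ tails↭)) ⟩
      + length X ℤ.+ ∑ φ X ∎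
      where
      open ≡-Reasoning
      ∑Y : ∑ φ Y ≡ ∑ (φ ∘ arrowHead (edgeDirection P?) (edgeTail P?)) edges
      ∑Y = begin
        ∑ φ Y                    ≡⟨ ∑-↭ φ heads↭ ⟨
        ∑ φ (map edgeHead edges) ≡⟨ ∑-map φ edgeHead edges ⟩
        ∑ (φ ∘ edgeHead) edges   ≡⟨ ∑-cong (λ e → cong φ (orient-step P? e)) edges ⟩
        ∑ (φ ∘ arrowHead (edgeDirection P?) (edgeTail P?)) edges ∎

-- Positions of a letter and inversions

tri : ℕ → ℕ
tri 0       = 0
tri (suc n) = n + tri n

tri*2 : ∀ n → tri n * 2 ≡ n * (n ∸ 1)
tri*2 0       = refl
tri*2 (suc 0) = refl
tri*2 (suc (suc n)) = begin
  (suc n + tri (suc n)) * 2     ≡⟨ ℕ.*-distribʳ-+ 2 (suc n) (tri (suc n)) ⟩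
  suc n * 2 + tri (suc n) * 2   ≡⟨ cong (λ k → suc n * 2 + k) (tri*2 (suc n)) ⟩
  suc n * 2 + suc n * n         ≡⟨ rearrange n ⟩
  suc (suc n) * suc n           ∎
  where
  open ≡-Reasoning
  rearrange : ∀ n → suc n * 2 + suc n * n ≡ suc (suc n) * suc n
  rearrange = ℕ-Ring.solve-∀

tri≡n*[n∸1]/2 : ∀ n → tri n ≡ n * (n ∸ 1) / 2
tri≡n*[n∸1]/2 n = trans (sym (m*n/n≡m (tri n) 2)) (/-congˡ {o = 2} (tri*2 n))

-- `tri` counts pairs: those inside either block, and the mixed ones. It serves to split `tri N`
-- along N = N₁ + N₀.
tri-+ : ∀ m n → tri (m + n) ≡ tri m + tri n + m * n
tri-+ 0       n = sym (ℕ.+-identityʳ (tri n))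
tri-+ (suc m) n = trans (cong (λ k → m + n + k) (tri-+ m n)) (rearrange m n (tri m) (tri n))
  where
  rearrange : ∀ m n s t → m + n + (s + t + m * n) ≡ m + s + t + suc m * n
  rearrange = ℕ-Ring.solve-∀

cnt : {A : Set} {P : Pred A 0ℓ} → Decidable P → List A → ℕ
cnt P? xs = length (filter P? xs)

filter-map : {A B : Set} {P : Pred B 0ℓ} (P? : Decidable P) (f : A → B) (xs : List A) →
             filter P? (map f xs) ≡ map f (filter (P? ∘ f) xs)
filter-map P? f []       = refl
filter-map P? f (x ∷ xs) with does (P? (f x))
... | true  = cong (f x ∷_) (filter-map P? f xs)
... | false = filter-map P? f xs

cnt-map : {A B : Set} {P : Pred B 0ℓ} {Q : Pred A 0ℓ} (P? : Decidable P) (Q? : Decidable Q)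
          (f : A → B) → (P ∘ f) ≐ Q → ∀ xs → cnt P? (map f xs) ≡ cnt Q? xs
cnt-map P? Q? f P∘f≐Q xs = trans (cong length (filter-map P? f xs))
  (trans (length-map f (filter (P? ∘ f) xs)) (cong length (filter-≐ (P? ∘ f) Q? P∘f≐Q xs)))

allFin-suc : ∀ n → allFin (suc n) ≡ zero ∷ map suc (allFin n)
allFin-suc n = cong (zero ∷_) (sym (map-tabulate id suc))

-- `c` is the letter whose vertices are deleted, so `kept 0F` lists the positions of the 1s and
-- `kept 1F` those of the 0s. The same convention holds for `positionSum`.
kept : ∀ {N} → Fin 2 → Word N → List (Fin N)
kept {N} c u = filter (λ i → ¬? (lookup u i Fin.≟ c)) (allFin N)

kept-∷-≡ : ∀ {N} c (u : Word N) → kept c (c ∷ᵛ u) ≡ map suc (kept c u)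
kept-∷-≡ {N} c u = trans (cong (filter P?) (allFin-suc N))
  (trans (filter-reject P? {x = zero} {xs = map suc (allFin N)} (λ c≢c → c≢c refl))
         (filter-map P? suc (allFin N)))
  where P? = λ i → ¬? (lookup (c ∷ᵛ u) i Fin.≟ c)

kept-∷-≢ : ∀ {N} c x (u : Word N) → x ≢ c → kept c (x ∷ᵛ u) ≡ zero ∷ map suc (kept c u)
kept-∷-≢ {N} c x u x≢c = trans (cong (filter P?) (allFin-suc N))
  (trans (filter-accept P? {x = zero} {xs = map suc (allFin N)} x≢c)
         (cong (zero ∷_) (filter-map P? suc (allFin N))))
  where P? = λ i → ¬? (lookup (x ∷ᵛ u) i Fin.≟ c)

length-kept-1 : ∀ {N} (u : Word N) → length (kept 1F u) ≡ ∣ u ∣₀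
length-kept-1 []ᵛ = refl
length-kept-1 (0F ∷ᵛ u) = trans (cong length (kept-∷-≢ 1F 0F u (λ ())))
  (cong suc (trans (length-map suc (kept 1F u)) (length-kept-1 u)))
length-kept-1 (1F ∷ᵛ u) = trans (cong length (kept-∷-≡ 1F u))
  (trans (length-map suc (kept 1F u)) (length-kept-1 u))

length-kept-0 : ∀ {N} (u : Word N) → length (kept 0F u) + ∣ u ∣₀ ≡ N
length-kept-0 []ᵛ = refl
length-kept-0 (0F ∷ᵛ u) = trans
  (cong (λ k → k + suc ∣ u ∣₀) (trans (cong length (kept-∷-≡ 0F u)) (length-map suc (kept 0F u))))
  (trans (ℕ.+-suc _ _) (cong suc (length-kept-0 u)))
length-kept-0 (1F ∷ᵛ u) = trans
  (cong (λ k → k + ∣ u ∣₀)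
    (trans (cong length (kept-∷-≢ 0F 1F u λ ())) (cong suc (length-map suc (kept 0F u)))))
  (cong suc (length-kept-0 u))

positionSum : ∀ {N} → Fin 2 → Word N → ℤ
positionSum c u = ∑ (λ i → + toℕ i) (kept c u)

∑-toℕ-suc : ∀ {N} (xs : List (Fin N)) →
            ∑ (λ i → + toℕ i) (map suc xs) ≡ ∑ (λ i → + toℕ i) xs ℤ.+ + length xs
∑-toℕ-suc xs = trans (∑-map _ suc xs) (trans
  (∑-affine {f = λ i → + toℕ i} 1ℤ 1ℤ (λ i → affine (+ toℕ i)) xs)
  (simplify (∑ (λ i → + toℕ i) xs) (+ length xs)))
  where
  affine : ∀ k → 1ℤ ℤ.+ k ≡ 1ℤ ℤ.* k ℤ.+ 1ℤ
  affine = ℤ-Ring.solve-∀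
  simplify : ∀ s l → 1ℤ ℤ.* s ℤ.+ l ℤ.* 1ℤ ≡ s ℤ.+ l
  simplify = ℤ-Ring.solve-∀

-- All old positions move up by one. The new letter sits at position 0 and adds nothing, whether
-- kept or not.
positionSum-∷ : ∀ {N} c x (u : Word N) →
                positionSum c (x ∷ᵛ u) ≡ positionSum c u ℤ.+ + length (kept c u)
positionSum-∷ c x u = by-head (x Fin.≟ c)
  where
  by-head : Dec (x ≡ c) → positionSum c (x ∷ᵛ u) ≡ positionSum c u ℤ.+ + length (kept c u)
  by-head (yes refl) = trans (cong (∑ _) (kept-∷-≡ c u)) (∑-toℕ-suc (kept c u))
  by-head (no x≢c)   = trans (cong (∑ _) (kept-∷-≢ c x u x≢c))
                             (trans (ℤ.+-identityˡ _) (∑-toℕ-suc (kept c u)))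

positionSum-total : ∀ {N} (u : Word N) → positionSum 0F u ℤ.+ positionSum 1F u ≡ + tri N
positionSum-total []ᵛ = refl
positionSum-total {suc N} (x ∷ᵛ u) = begin
  positionSum 0F (x ∷ᵛ u) ℤ.+ positionSum 1F (x ∷ᵛ u)
    ≡⟨ cong₂ ℤ._+_ (positionSum-∷ 0F x u) (positionSum-∷ 1F x u) ⟩
  (positionSum 0F u ℤ.+ + length (kept 0F u)) ℤ.+ (positionSum 1F u ℤ.+ + length (kept 1F u))
    ≡⟨ regroup (positionSum 0F u) (+ length (kept 0F u)) (positionSum 1F u) (+ length (kept 1F u)) ⟩
  + (length (kept 0F u) + length (kept 1F u)) ℤ.+ (positionSum 0F u ℤ.+ positionSum 1F u)
    ≡⟨ cong₂ ℤ._+_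
         (cong +_ (trans (cong (λ k → length (kept 0F u) + k) (length-kept-1 u)) (length-kept-0 u)))
         (positionSum-total u) ⟩
  + N ℤ.+ + tri N ∎
  where
  open ≡-Reasoning
  regroup : ∀ s k t l → (s ℤ.+ k) ℤ.+ (t ℤ.+ l) ≡ (k ℤ.+ l) ℤ.+ (s ℤ.+ t)
  regroup = ℤ-Ring.solve-∀

cnt-++ : {A : Set} {P : Pred A 0ℓ} (P? : Decidable P) (xs ys : List A) →
         cnt P? (xs ++ ys) ≡ cnt P? xs + cnt P? ys
cnt-++ P? xs ys = trans (cong length (filter-++ P? xs ys)) (length-++ (filter P? xs))

-- No inversion ends at position 0, and the common shift by one of the other positions preserves
-- order and letters.
cnt-inversions-suc : ∀ {N} x (u : Word N) (is js : List (Fin N)) →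
  cnt (inversion? (x ∷ᵛ u)) (cartesianProduct (map suc is) (zero ∷ map suc js)) ≡
  cnt (inversion? u) (cartesianProduct is js)
cnt-inversions-suc x u []       js = refl
cnt-inversions-suc x u (i ∷ is) js = begin
  cnt I? (((suc i , zero) ∷ map (suc i ,_) (map suc js)) ++ rest)
    ≡⟨ cnt-++ I? ((suc i , zero) ∷ map (suc i ,_) (map suc js)) rest ⟩
  cnt I? ((suc i , zero) ∷ map (suc i ,_) (map suc js)) + cnt I? rest
    ≡⟨ cong₂ _+_ row (cnt-inversions-suc x u is js) ⟩
  cnt (inversion? u) (map (i ,_) js) + cnt (inversion? u) (cartesianProduct is js)
    ≡⟨ cnt-++ (inversion? u) (map (i ,_) js) (cartesianProduct is js) ⟨
  cnt (inversion? u) (map (i ,_) js ++ cartesianProduct is js) ∎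
  where
  open ≡-Reasoning
  I? = inversion? (x ∷ᵛ u)
  rest = cartesianProduct (map suc is) (zero ∷ map suc js)
  row : cnt I? ((suc i , zero) ∷ map (suc i ,_) (map suc js)) ≡ cnt (inversion? u) (map (i ,_) js)
  row = begin
    cnt I? ((suc i , zero) ∷ map (suc i ,_) (map suc js))
      ≡⟨ cong length (filter-reject I? {x = suc i , zero} {xs = map (suc i ,_) (map suc js)} λ ()) ⟩
    cnt I? (map (suc i ,_) (map suc js))
      ≡⟨ cnt-map I? (I? ∘ (suc i ,_)) (suc i ,_) (id , id) (map suc js) ⟩
    cnt (I? ∘ (suc i ,_)) (map suc js)
      ≡⟨ cnt-map (I? ∘ (suc i ,_)) (inversion? u ∘ (i ,_)) suc
           ((λ (i<j , eqs) → s<s⁻¹ i<j , eqs) , (λ (i<j , eqs) → s<s i<j , eqs)) js ⟩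
    cnt (inversion? u ∘ (i ,_)) js
      ≡⟨ cnt-map (inversion? u) (inversion? u ∘ (i ,_)) (i ,_) (id , id) js ⟨
    cnt (inversion? u) (map (i ,_) js) ∎

inversionsFromZero : ∀ {N} → Word (suc N) → ℕ
inversionsFromZero {N} u = cnt (inversion? u ∘ (zero ,_)) (allFin (suc N))

d-∷ : ∀ {N} x (u : Word N) → d (x ∷ᵛ u) ≡ inversionsFromZero (x ∷ᵛ u) + d u
d-∷ {N} x u = begin
  cnt I? (map (zero ,_) (allFin (suc N)) ++ cartesianProduct (tabulate suc) (allFin (suc N)))
    ≡⟨ cnt-++ I? (map (zero ,_) (allFin (suc N))) _ ⟩
  cnt I? (map (zero ,_) (allFin (suc N))) + cnt I? (cartesianProduct (tabulate suc) (allFin (suc N)))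
    ≡⟨ cong₂ _+_ (cnt-map I? (I? ∘ (zero ,_)) (zero ,_) (id , id) (allFin (suc N)))
        (trans (cong (λ is → cnt I? (cartesianProduct is (zero ∷ is))) (sym (map-tabulate id suc)))
               (cnt-inversions-suc x u (allFin N) (allFin N))) ⟩
  inversionsFromZero (x ∷ᵛ u) + d u ∎
  where
  open ≡-Reasoning
  I? = inversion? (x ∷ᵛ u)

inversionsFromZero-0 : ∀ {N} (u : Word N) → inversionsFromZero (0F ∷ᵛ u) ≡ 0
inversionsFromZero-0 u = cong length
  (filter-none (inversion? (0F ∷ᵛ u) ∘ (zero ,_)) (All.universal (λ { _ (_ , () , _) }) (allFin _)))

inversionsFromZero-1 : ∀ {N} (u : Word N) → inversionsFromZero (1F ∷ᵛ u) ≡ ∣ u ∣₀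
inversionsFromZero-1 {N} u = begin
  cnt J? (zero ∷ tabulate suc)
    ≡⟨ cong length (filter-reject J? {x = zero} {xs = tabulate suc} λ ()) ⟩
  cnt J? (tabulate suc)
    ≡⟨ cong (cnt J?) (map-tabulate id suc) ⟨
  cnt J? (map suc (allFin N))
    ≡⟨ cnt-map J? (λ i → ¬? (lookup u i Fin.≟ 1F)) suc
         ((λ (_ , _ , eq) → ≡0⇒≢1 eq) , (λ ≢1 → z<s , refl , ≢1⇒≡0 ≢1)) (allFin N) ⟩
  length (kept 1F u)
    ≡⟨ length-kept-1 u ⟩
  ∣ u ∣₀ ∎
  where
  open ≡-Reasoning
  J? = inversion? (1F ∷ᵛ u) ∘ (zero ,_)
  ≡0⇒≢1 : ∀ {x : Fin 2} → x ≡ 0F → x ≢ 1F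
  ≡0⇒≢1 refl ()
  ≢1⇒≡0 : ∀ {x : Fin 2} → x ≢ 1F → x ≡ 0F
  ≢1⇒≡0 {0F} _   = refl
  ≢1⇒≡0 {1F} 1≢1 = contradiction refl 1≢1

-- The position of a 0 is the number of letters before it: the earlier 0s add up to `tri ∣ u ∣₀`,
-- the earlier 1s to `d u`. In the induction a new first letter raises the sum by `∣ u ∣₀`; a 0
-- books this increase under `tri`, a 1 under `d`.
positionSum-1 : ∀ {N} (u : Word N) → positionSum 1F u ≡ + (tri ∣ u ∣₀ + d u)
positionSum-1 []ᵛ = refl
positionSum-1 (x ∷ᵛ u) = begin
  positionSum 1F (x ∷ᵛ u)
    ≡⟨ positionSum-∷ 1F x u ⟩
  positionSum 1F u ℤ.+ + length (kept 1F u)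
    ≡⟨ cong₂ (λ s k → s ℤ.+ + k) (positionSum-1 u) (length-kept-1 u) ⟩
  + (tri ∣ u ∣₀ + d u + ∣ u ∣₀)
    ≡⟨ cong +_ (trans (case x) (cong (λ k → tri ∣ x ∷ᵛ u ∣₀ + k) (sym (d-∷ x u)))) ⟩
  + (tri ∣ x ∷ᵛ u ∣₀ + d (x ∷ᵛ u)) ∎
  where
  open ≡-Reasoning
  regroup₀ : ∀ t e n → t + e + n ≡ n + t + e
  regroup₀ = ℕ-Ring.solve-∀
  regroup₁ : ∀ t e n → t + e + n ≡ t + (n + e)
  regroup₁ = ℕ-Ring.solve-∀
  case : ∀ x → tri ∣ u ∣₀ + d u + ∣ u ∣₀ ≡ tri ∣ x ∷ᵛ u ∣₀ + (inversionsFromZero (x ∷ᵛ u) + d u)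
  case 0F = trans (regroup₀ (tri ∣ u ∣₀) (d u) ∣ u ∣₀)
    (cong (λ k → ∣ u ∣₀ + tri ∣ u ∣₀ + (k + d u)) (sym (inversionsFromZero-0 u)))
  case 1F = trans (regroup₁ (tri ∣ u ∣₀) (d u) ∣ u ∣₀)
    (cong (λ k → tri ∣ u ∣₀ + (k + d u)) (sym (inversionsFromZero-1 u)))

-- The vertices of G N, Gₒ and Gₑ

half : ∀ m → ∃[ b ] (m ≡ b + b ⊎ m ≡ suc (b + b))
half 0       = 0 , inj₁ refl
half (suc m) with half m
... | b , inj₁ refl = b , inj₂ refl
... | b , inj₂ refl = suc b , inj₁ (cong suc (sym (ℕ.+-suc b b)))

2∤suc : ∀ {n} → 2 ∣ n → ¬ 2 ∣ suc n
2∤suc {n} 2∣n 2∣1+n with ∣1⇒≡1 (∣m+n∣m⇒∣n {m = n} (subst (2 ∣_) (ℕ.+-comm 1 n) 2∣1+n) 2∣n)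
... | ()

2∣suc : ∀ {n} → ¬ 2 ∣ n → 2 ∣ suc n
2∣suc {n} 2∤n with half n
... | b , inj₁ refl = contradiction (divides b (double b)) 2∤n
  where
  double : ∀ b → b + b ≡ b * 2
  double = ℕ-Ring.solve-∀
... | b , inj₂ refl = divides (suc b) (double b)
  where
  double : ∀ b → suc (suc (b + b)) ≡ suc b * 2
  double = ℕ-Ring.solve-∀

EvenInteger : Pred ℤ 0ℓ
EvenInteger z = 2 ∣ ∣ z ∣

parity-+1 : ∀ z → (EvenInteger z × ¬ EvenInteger (z ℤ.+ 1ℤ))
                ⊎ (¬ EvenInteger z × EvenInteger (z ℤ.+ 1ℤ))
parity-+1 (+ n) rewrite ℕ.+-comm n 1 with 2 ∣? n
... | yes 2∣n = inj₁ (2∣n , 2∤suc 2∣n)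
... | no  2∤n = inj₂ (2∤n , 2∣suc 2∤n)
-- Adding 1 to a negative integer lowers its absolute value, from `suc n` to `n`, so the two parity
-- cases change places.
parity-+1 -[1+ n ] rewrite trans (cong ∣_∣ (ℤ.[1+m]⊖[1+n]≡m⊖n 0 n)) (ℤ.∣⊖∣-≤ {0} {n} z≤n) with 2 ∣? n
... | yes 2∣n = inj₂ (2∤suc 2∣n , 2∣n)
... | no  2∤n = inj₁ (2∣suc 2∤n , 2∤n)

odd-bipartite : Bipartite OddVertex
odd-bipartite (horizontal p) rewrite diag-step right p = parity-+1 (diag p)
odd-bipartite (vertical p)   rewrite diag-step up p    = parity-+1 (diag p)

even-bipartite : Bipartite EvenVertex
even-bipartite e with odd-bipartite e
... | inj₁ (odd , ¬odd) = inj₂ ((λ ¬o → ¬o odd) , ¬odd)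
... | inj₂ (¬odd , odd) = inj₁ (¬odd , (λ ¬o → ¬o odd))

-- a and b count the diagonal steps from a vertex to the left and right side of G N.
oddPt evenPt : ℕ → ℕ → Point
oddPt  a b = a ⊖ b , - (+ (a + b))
evenPt a b = a ⊖ b , - (+ suc (a + b))

private
  diag-⊖ : ∀ a b c → a ⊖ b ℤ.+ - + (c + (a + b)) ≡ - + (c + 2 * b)
  diag-⊖ a b c = begin
    a ⊖ b ℤ.+ - (+ c ℤ.+ (+ a ℤ.+ + b))
      ≡⟨ cong (λ z → z ℤ.+ - (+ c ℤ.+ (+ a ℤ.+ + b))) (sym (ℤ.m-n≡m⊖n a b)) ⟩
    + a - + b ℤ.+ - (+ c ℤ.+ (+ a ℤ.+ + b))
      ≡⟨ lemma (+ a) (+ b) (+ c) ⟩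
    - (+ c ℤ.+ + 2 ℤ.* + b)
      ≡⟨ cong (λ z → - (+ c ℤ.+ z)) (sym (ℤ.pos-* 2 b)) ⟩
    - + (c + 2 * b) ∎
    where
    open ≡-Reasoning
    lemma : ∀ a b c → a - b ℤ.+ - (c ℤ.+ (a ℤ.+ b)) ≡ - (c ℤ.+ + 2 ℤ.* b)
    lemma = ℤ-Ring.solve-∀

  antidiag-⊖ : ∀ a b c → a ⊖ b - - + (c + (a + b)) ≡ + (c + 2 * a)
  antidiag-⊖ a b c = begin
    a ⊖ b - - (+ c ℤ.+ (+ a ℤ.+ + b))
      ≡⟨ cong (λ z → z - - (+ c ℤ.+ (+ a ℤ.+ + b))) (sym (ℤ.m-n≡m⊖n a b)) ⟩
    + a - + b - - (+ c ℤ.+ (+ a ℤ.+ + b))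
      ≡⟨ lemma (+ a) (+ b) (+ c) ⟩
    + c ℤ.+ + 2 ℤ.* + a
      ≡⟨ cong (λ z → + c ℤ.+ z) (sym (ℤ.pos-* 2 a)) ⟩
    + (c + 2 * a) ∎
    where
    open ≡-Reasoning
    lemma : ∀ a b c → a - b - - (c ℤ.+ (a ℤ.+ b)) ≡ c ℤ.+ + 2 ℤ.* a
    lemma = ℤ-Ring.solve-∀

-- In these coordinates `diag` sees only `b` and `antidiag` only `a`. Injectivity and the colour of
-- a point are read off from these values.
diag-oddPt : ∀ a b → diag (oddPt a b) ≡ - + (2 * b)
diag-oddPt a b = diag-⊖ a b 0

diag-evenPt : ∀ a b → diag (evenPt a b) ≡ - + suc (2 * b)
diag-evenPt a b = diag-⊖ a b 1

antidiag-oddPt : ∀ a b → antidiag (oddPt a b) ≡ + (2 * a)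
antidiag-oddPt a b = antidiag-⊖ a b 0

antidiag-evenPt : ∀ a b → antidiag (evenPt a b) ≡ + suc (2 * a)
antidiag-evenPt a b = antidiag-⊖ a b 1

oddPt-injective : ∀ a b a′ b′ → oddPt a b ≡ oddPt a′ b′ → a ≡ a′ × b ≡ b′
oddPt-injective a b a′ b′ eq =
    ℕ.*-cancelˡ-≡ a a′ 2 (ℤ.+-injective
      (trans (sym (antidiag-oddPt a b)) (trans (cong antidiag eq) (antidiag-oddPt a′ b′))))
  , ℕ.*-cancelˡ-≡ b b′ 2 (ℤ.+-injective (ℤ.neg-injective
      (trans (sym (diag-oddPt a b)) (trans (cong diag eq) (diag-oddPt a′ b′)))))

evenPt-injective : ∀ a b a′ b′ → evenPt a b ≡ evenPt a′ b′ → a ≡ a′ × b ≡ b′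
evenPt-injective a b a′ b′ eq =
    ℕ.*-cancelˡ-≡ a a′ 2 (ℕ.suc-injective (ℤ.+-injective
      (trans (sym (antidiag-evenPt a b)) (trans (cong antidiag eq) (antidiag-evenPt a′ b′)))))
  , ℕ.*-cancelˡ-≡ b b′ 2 (ℕ.suc-injective (ℤ.+-injective (ℤ.neg-injective
      (trans (sym (diag-evenPt a b)) (trans (cong diag eq) (diag-evenPt a′ b′))))))

oddPt-odd : ∀ a b → OddVertex (oddPt a b)
oddPt-odd a b = subst (2 ∣_) (sym (trans (cong ∣_∣ (diag-oddPt a b)) (ℤ.∣-i∣≡∣i∣ (+ (2 * b))))) (m∣m*n b)

evenPt-even : ∀ a b → EvenVertex (evenPt a b)
evenPt-even a b = 2∤suc (m∣m*n b) ∘ subst (2 ∣_) (cong ∣_∣ (diag-evenPt a b))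

oddPt∈G : ∀ {N} a b → 1 ≤ a + b → a + b ≤ N → oddPt a b ∈ G N
oddPt∈G a b 1≤ ≤N = a + b , 1≤ , ≤N , refl , ℕ.≤-trans (ℤ.∣m⊝n∣≤m⊔n a b) (ℕ.m⊔n≤m+n a b)

evenPt∈G : ∀ {N} a b → a + b < N → evenPt a b ∈ G N
evenPt∈G a b <N = suc (a + b) , s≤s z≤n , <N , refl ,
  ℕ.m≤n⇒m≤1+n (ℕ.≤-trans (ℤ.∣m⊝n∣≤m⊔n a b) (ℕ.m⊔n≤m+n a b))

-- Half of `i ∸ ∣ x ∣`, rounded down, is the smaller coordinate, and adding `∣ x ∣` gives the other;
-- the sign of `x` decides which is which. The remainder of the halving is the colour.
coordinates : ∀ x i → ∣ x ∣ ≤ i → ∃[ a ] ∃[ b ] x ≡ a ⊖ b × (i ≡ a + b ⊎ i ≡ suc (a + b))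
coordinates (+ n) i n≤i with half (i ∸ n) | ℕ.m+[n∸m]≡n n≤i
... | b , h | eq = n + b , b , sym (trans (sym (ℤ.m-n≡m⊖n (n + b) b)) (cancel (+ n) (+ b))) , sum h
  where
  cancel : ∀ n b → n ℤ.+ b - b ≡ n
  cancel = ℤ-Ring.solve-∀
  sum : i ∸ n ≡ b + b ⊎ i ∸ n ≡ suc (b + b) → i ≡ n + b + b ⊎ i ≡ suc (n + b + b)
  sum (inj₁ h) = inj₁ (trans (sym eq) (trans (cong (λ k → n + k) h) (sym (ℕ.+-assoc n b b))))
  sum (inj₂ h) = inj₂ (trans (sym eq) (trans (cong (λ k → n + k) h)
                   (trans (ℕ.+-suc n (b + b)) (cong suc (sym (ℕ.+-assoc n b b))))))
coordinates -[1+ n ] i n≤i with half (i ∸ suc n) | ℕ.m+[n∸m]≡n n≤i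
... | b , h | eq = b , suc n + b , sym (trans (sym (ℤ.m-n≡m⊖n b (suc n + b))) (cancel (+ suc n) (+ b))) , sum h
  where
  cancel : ∀ n b → b - (n ℤ.+ b) ≡ - n
  cancel = ℤ-Ring.solve-∀
  regroup : ∀ n b → n + (b + b) ≡ b + (n + b)
  regroup = ℕ-Ring.solve-∀
  sum : i ∸ suc n ≡ b + b ⊎ i ∸ suc n ≡ suc (b + b) → i ≡ b + (suc n + b) ⊎ i ≡ suc (b + (suc n + b))
  sum (inj₁ h) = inj₁ (trans (sym eq) (trans (cong (λ k → suc n + k) h) (regroup (suc n) b)))
  sum (inj₂ h) = inj₂ (trans (sym eq) (trans (cong (λ k → suc n + k) h)
                   (trans (ℕ.+-suc (suc n) (b + b)) (cong suc (regroup (suc n) b)))))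

G-coordinates : ∀ {N p} → p ∈ G N →
  (∃[ a ] ∃[ b ] p ≡ oddPt a b × 1 ≤ a + b × a + b ≤ N)
  ⊎ (∃[ a ] ∃[ b ] p ≡ evenPt a b × a + b < N)
G-coordinates {p = x , _} (i , 1≤i , i≤N , refl , ∣x∣≤i) with coordinates x i ∣x∣≤i
... | a , b , refl , inj₁ refl = inj₁ (a , b , refl , 1≤i , i≤N)
... | a , b , refl , inj₂ refl = inj₂ (a , b , refl , i≤N)

B-coordinates : ∀ {N} (j : Fin N) → B N j ≡ evenPt (toℕ j) (N ∸ suc (toℕ j))
B-coordinates {N} j = cong₂ _,_ first (cong (λ k → - + k) (sym N≡))
  where
  b = N ∸ suc (toℕ j)
  N≡ : suc (toℕ j + b) ≡ N
  N≡ = ℕ.m+[n∸m]≡n (Fin.toℕ<n j)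
  lemma : ∀ j b → - (1ℤ ℤ.+ (j ℤ.+ b)) ℤ.+ (1ℤ ℤ.+ + 2 ℤ.* j) ≡ j - b
  lemma = ℤ-Ring.solve-∀
  open ≡-Reasoning
  first : - (+ N) ℤ.+ + (1 + 2 * toℕ j) ≡ toℕ j ⊖ b
  first = begin
    - (+ N) ℤ.+ + (1 + 2 * toℕ j)
      ≡⟨ cong₂ (λ k z → - (+ k) ℤ.+ (1ℤ ℤ.+ z)) (sym N≡) (ℤ.pos-* 2 (toℕ j)) ⟩
    - (1ℤ ℤ.+ (+ toℕ j ℤ.+ + b)) ℤ.+ (1ℤ ℤ.+ + 2 ℤ.* + toℕ j)
      ≡⟨ lemma (+ toℕ j) (+ b) ⟩
    + toℕ j - + b
      ≡⟨ ℤ.m-n≡m⊖n (toℕ j) b ⟩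
    toℕ j ⊖ b ∎

L-coordinates : ∀ {N} (j : Fin N) → L N j ≡ oddPt 0 (N ∸ toℕ j)
L-coordinates {N} j = cong (_, - (+ (N ∸ toℕ j))) (neg (N ∸ toℕ j))
  where
  neg : ∀ k → - (+ k) ≡ 0 ⊖ k
  neg 0       = refl
  neg (suc k) = refl

R-coordinates : ∀ {N} (j : Fin N) → R N j ≡ oddPt (suc (toℕ j)) 0
R-coordinates j = cong (λ k → + suc (toℕ j) , - + k) (sym (ℕ.+-identityʳ (suc (toℕ j))))

-- This identifies the odd vertices below even ones as those with both coordinates positive, that
-- is, those on neither side of the triangle.
step-down-even : ∀ a b → step down (evenPt a b) ≡ oddPt (suc a) (suc b)
step-down-even a b = cong₂ _,_ (sym (ℤ.[1+m]⊖[1+n]≡m⊖n a b))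
  (cong (λ k → - + suc k) (trans (cong suc (ℕ.+-identityʳ (a + b))) (sym (ℕ.+-suc a b))))

-- Listing the two colour classes

leftSide : ℕ → List (ℕ × ℕ)
leftSide n = map (0 ,_) (upTo n)

-- The pairs with `a + b < n`, by increasing `a`. With n = N - 1 they index the even vertices above
-- the bottom row and, moved down, the inner odd vertices.
triangle : ℕ → List (ℕ × ℕ)
triangle 0       = []
triangle (suc n) = leftSide (suc n) ++ map (map₁ suc) (triangle n)

length-triangle : ∀ n → length (triangle n) ≡ tri (suc n)
length-triangle 0       = refl
length-triangle (suc n) = trans (length-++ (leftSide (suc n)) {map (map₁ suc) (triangle n)}) (cong₂ _+_
  (trans (length-map {B = ℕ × ℕ} (0 ,_) (upTo (suc n))) (length-upTo (suc n)))
  (trans (length-map (map₁ suc) (triangle n)) (length-triangle n)))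

∈-triangle⁺ : ∀ n {a b} → a + b < n → (a , b) ∈ₗ triangle n
∈-triangle⁺ (suc n) {0}     b<n   = ∈-++⁺ˡ (∈-map⁺ (0 ,_) (∈-upTo⁺ b<n))
∈-triangle⁺ (suc n) {suc a} a+b<n =
  ∈-++⁺ʳ (leftSide (suc n)) (∈-map⁺ (map₁ suc) (∈-triangle⁺ n (s<s⁻¹ a+b<n)))

∈-triangle⁻ : ∀ n {a b} → (a , b) ∈ₗ triangle n → a + b < n
∈-triangle⁻ (suc n) ab∈ with ∈-++⁻ (leftSide (suc n)) ab∈
... | inj₁ ∈row with _ , b∈ , refl ← ∈-map⁻ _ ∈row = ∈-upTo⁻ b∈
... | inj₂ ∈rest with _ , ab∈′ , refl ← ∈-map⁻ (map₁ suc) ∈rest = s<s (∈-triangle⁻ n ab∈′)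

unique-triangle : ∀ n → Unique (triangle n)
unique-triangle 0       = []
unique-triangle (suc n) = Unique.++⁺
  (Unique.map⁺ ,-injectiveʳ (Unique.upTo⁺ (suc n)))
  (Unique.map⁺ (λ eq → cong₂ _,_ (ℕ.suc-injective (,-injectiveˡ eq)) (,-injectiveʳ eq)) (unique-triangle n))
  disjoint
  where
  disjoint : ∀ {q} → q ∈ₗ leftSide (suc n) × q ∈ₗ map (map₁ suc) (triangle n) → _
  disjoint (∈row , ∈rest) with _ , _ , refl ← ∈-map⁻ _ ∈row with _ , _ , () ← ∈-map⁻ (map₁ suc) ∈rest

innerEven innerOdd : ℕ × ℕ → Point
innerEven (a , b) = evenPt a b
innerOdd = step down ∘ innerEven

innerEven-injective : ∀ {ab ab′} → innerEven ab ≡ innerEven ab′ → ab ≡ ab′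
innerEven-injective {a , b} {a′ , b′} eq with evenPt-injective a b a′ b′ eq
... | refl , refl = refl

innerOdd-injective : ∀ {ab ab′} → innerOdd ab ≡ innerOdd ab′ → ab ≡ ab′
innerOdd-injective {a , b} {a′ , b′} eq
  with oddPt-injective (suc a) (suc b) (suc a′) (suc b′)
         (trans (sym (step-down-even a b)) (trans eq (step-down-even a′ b′)))
... | refl , refl = refl

-- The common shape of Gₒ u w (A = R N, A′ = L N) and Gₑ v w (A = L N, A′ = R N).
Truncated : ∀ {N} → Fin 2 → (A A′ : Fin N → Point) → (u w : Word N) → InducedSubgraph
Truncated {N} c A A′ u w p =
    p ∈ G N
  × (∀ i → p ≢ A i)
  × (∀ i → lookup w i ≡ c → p ≢ B N i)
  × (∀ i → lookup u i ≡ c → p ≢ A′ i)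

module _ {n : ℕ} where

  private
    N = suc n

  -- `A` is the side deleted altogether, `A′` the side thinned out by a word. The reflection of the
  -- triangle does not match `L` with `R` index by index, since one is numbered upwards and the
  -- other downwards; this interface holds what the two sides share.
  record Sides (A A′ : Fin N → Point) : Set where
    field
      A-odd        : ∀ i → OddVertex (A i)
      A′-odd       : ∀ i → OddVertex (A′ i)
      A′∈G         : ∀ i → A′ i ∈ G N
      A′-injective : ∀ {i j} → A′ i ≡ A′ j → i ≡ j
      A≢A′         : ∀ i j → A i ≢ A′ j
      inner≢A      : ∀ ab i → innerOdd ab ≢ A i
      inner≢A′     : ∀ ab i → innerOdd ab ≢ A′ i
      cover        : ∀ a b → 1 ≤ a + b → a + b ≤ N →
                     (∃[ ab ] ab ∈ₗ triangle n × oddPt a b ≡ innerOdd ab)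
                     ⊎ (∃[ i ] oddPt a b ≡ A i) ⊎ (∃[ i ] oddPt a b ≡ A′ i)

  private
    L-odd : ∀ i → OddVertex (L N i)
    L-odd i = subst OddVertex (sym (L-coordinates i)) (oddPt-odd 0 (N ∸ toℕ i))

    R-odd : ∀ i → OddVertex (R N i)
    R-odd i = subst OddVertex (sym (R-coordinates i)) (oddPt-odd (suc (toℕ i)) 0)

    L∈G : ∀ i → L N i ∈ G N
    L∈G i = subst (G N) (sym (L-coordinates i))
      (oddPt∈G 0 (N ∸ toℕ i) (ℕ.m<n⇒0<n∸m (Fin.toℕ<n i)) (ℕ.m∸n≤m N (toℕ i)))

    R∈G : ∀ i → R N i ∈ G N
    R∈G i = subst (G N) (sym (R-coordinates i))
      (oddPt∈G (suc (toℕ i)) 0 (s≤s z≤n) (subst (_≤ N) (sym (ℕ.+-identityʳ _)) (Fin.toℕ<n i)))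

    L-injective : ∀ {i j} → L N i ≡ L N j → i ≡ j
    L-injective {i} {j} eq = Fin.toℕ-injective (ℕ.∸-cancelˡ-≡ (ℕ.<⇒≤ (Fin.toℕ<n i)) (ℕ.<⇒≤ (Fin.toℕ<n j))
      (proj₂ (oddPt-injective 0 (N ∸ toℕ i) 0 (N ∸ toℕ j)
        (trans (sym (L-coordinates i)) (trans eq (L-coordinates j))))))

    R-injective : ∀ {i j} → R N i ≡ R N j → i ≡ j
    R-injective {i} {j} eq = Fin.toℕ-injective (ℕ.suc-injective
      (proj₁ (oddPt-injective (suc (toℕ i)) 0 (suc (toℕ j)) 0
        (trans (sym (R-coordinates i)) (trans eq (R-coordinates j))))))

    L≢R : ∀ i j → L N i ≢ R N j
    L≢R i j eq with proj₁ (oddPt-injective 0 (N ∸ toℕ i) (suc (toℕ j)) 0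
                 (trans (sym (L-coordinates i)) (trans eq (R-coordinates j))))
    ... | ()

    inner≢L : ∀ ab i → innerOdd ab ≢ L N i
    inner≢L (a , b) i eq
      with proj₁ (oddPt-injective (suc a) (suc b) 0 (N ∸ toℕ i)
                   (trans (sym (step-down-even a b)) (trans eq (L-coordinates i))))
    ... | ()

    inner≢R : ∀ ab i → innerOdd ab ≢ R N i
    inner≢R (a , b) i eq
      with proj₂ (oddPt-injective (suc a) (suc b) (suc (toℕ i)) 0
                   (trans (sym (step-down-even a b)) (trans eq (R-coordinates i))))
    ... | ()

    -- Two positive coordinates mean an inner vertex, and a single zero coordinate names the side.
    -- Both being zero would be the point above the top row, excluded by `1 ≤ a + b`.
    LR-cover : ∀ a b → 1 ≤ a + b → a + b ≤ N →
               (∃[ ab ] ab ∈ₗ triangle n × oddPt a b ≡ innerOdd ab)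
               ⊎ (∃[ i ] oddPt a b ≡ L N i) ⊎ (∃[ i ] oddPt a b ≡ R N i)
    LR-cover (suc a) (suc b) _ ≤N = inj₁ ((a , b) ,
      ∈-triangle⁺ n (ℕ.≤-trans (ℕ.≤-reflexive (sym (ℕ.+-suc a b))) (s≤s⁻¹ ≤N)) , sym (step-down-even a b))
    LR-cover (suc a) 0 _ ≤N = inj₂ (inj₂ (fromℕ< a<N ,
      sym (trans (R-coordinates (fromℕ< a<N)) (cong (λ k → oddPt (suc k) 0) (Fin.toℕ-fromℕ< a<N)))))
      where
      a<N : a < N
      a<N = subst (_≤ N) (ℕ.+-identityʳ (suc a)) ≤N
    -- The left vertices are numbered from the bottom, so the one in row `suc b` has index
    -- `N ∸ suc b`.
    LR-cover 0 (suc b) _ ≤N = inj₂ (inj₁ (fromℕ< N∸b<N ,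
      sym (trans (L-coordinates (fromℕ< N∸b<N)) (cong (oddPt 0)
        (trans (cong (λ k → N ∸ k) (Fin.toℕ-fromℕ< N∸b<N)) (ℕ.m∸[m∸n]≡n ≤N))))))
      where
      N∸b<N : N ∸ suc b < N
      N∸b<N = s≤s (ℕ.m∸n≤m n b)
    LR-cover 0 0 () _

  sides-LR : Sides (L N) (R N)
  sides-LR = record
    { A-odd = L-odd ; A′-odd = R-odd ; A′∈G = R∈G ; A′-injective = R-injective ; A≢A′ = L≢R
    ; inner≢A = inner≢L ; inner≢A′ = inner≢R ; cover = LR-cover }

  sides-RL : Sides (R N) (L N)
  sides-RL = record
    { A-odd = R-odd ; A′-odd = L-odd ; A′∈G = L∈G ; A′-injective = L-injective ; A≢A′ = λ i j → L≢R j i ∘ sym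
    ; inner≢A = inner≢R ; inner≢A′ = inner≢L ; cover = λ a b 1≤ ≤N → Sum.map₂ swap (LR-cover a b 1≤ ≤N) }

  evens odds : Fin 2 → (Fin N → Point) → Word N → List Point
  evens c A u = map innerEven (triangle n) ++ map A (kept c u)
  odds  c A u = map innerOdd (triangle n) ++ map A (kept c u)

  ∈-kept⁺ : ∀ c (u : Word N) {i} → lookup u i ≢ c → i ∈ₗ kept c u
  ∈-kept⁺ c u {i} ≢c = ∈-filter⁺ (λ i → ¬? (lookup u i Fin.≟ c)) (∈-allFin i) ≢c

  ∈-kept⁻ : ∀ c (u : Word N) {i} → i ∈ₗ kept c u → lookup u i ≢ c
  ∈-kept⁻ c u i∈ = proj₂ (∈-filter⁻ (λ i → ¬? (lookup u i Fin.≟ c)) {xs = allFin N} i∈)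

  unique-kept : ∀ c (u : Word N) → Unique (kept c u)
  unique-kept c u = Unique.filter⁺ (λ i → ¬? (lookup u i Fin.≟ c)) (Unique.allFin⁺ N)

  B-injective : ∀ {i j} → B N i ≡ B N j → i ≡ j
  B-injective {i} {j} eq = Fin.toℕ-injective
    (proj₁ (evenPt-injective (toℕ i) (n ∸ toℕ i) (toℕ j) (n ∸ toℕ j)
      (trans (sym (B-coordinates i)) (trans eq (B-coordinates j)))))

  B-even : ∀ i → EvenVertex (B N i)
  B-even i = subst EvenVertex (sym (B-coordinates i)) (evenPt-even (toℕ i) (n ∸ toℕ i))

  toℕ+[n∸toℕ]≡n : ∀ (i : Fin N) → toℕ i + (n ∸ toℕ i) ≡ n
  toℕ+[n∸toℕ]≡n i = ℕ.m+[n∸m]≡n (s≤s⁻¹ (Fin.toℕ<n i))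

  B∈G : ∀ i → B N i ∈ G N
  B∈G i = subst (G N) (sym (B-coordinates i))
    (evenPt∈G (toℕ i) (n ∸ toℕ i) (s≤s (ℕ.≤-reflexive (toℕ+[n∸toℕ]≡n i))))

  inner≢B : ∀ a b i → a + b < n → evenPt a b ≢ B N i
  inner≢B a b i a+b<n eq with evenPt-injective a b (toℕ i) (n ∸ toℕ i) (trans eq (B-coordinates i))
  ... | refl , refl = ℕ.<⇒≢ a+b<n (toℕ+[n∸toℕ]≡n i)

  module _ {A A′ : Fin N → Point} (sides : Sides A A′) (c : Fin 2) (u w : Word N) where
    open Sides sides

    private
      V = Truncated c A A′ u w

      even≢odd : ∀ {p q} → EvenVertex p → OddVertex q → p ≢ q
      even≢odd even odd refl = even odd

    enumerate-evens : Enumeration V EvenVertex (evens c (B N) w)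
    enumerate-evens = record { unique = unique ; sound = sound ; complete = complete }
      where
      unique : Unique (evens c (B N) w)
      unique = Unique.++⁺ (Unique.map⁺ innerEven-injective (unique-triangle n))
                          (Unique.map⁺ B-injective (unique-kept c w)) disjoint
        where
        disjoint : ∀ {p} → p ∈ₗ map innerEven (triangle n) × p ∈ₗ map (B N) (kept c w) → ⊥
        disjoint (∈inner , ∈B)
          with (a , b) , ab∈ , refl ← ∈-map⁻ innerEven ∈inner
          with i , _ , eq ← ∈-map⁻ (B N) ∈B = inner≢B a b i (∈-triangle⁻ n ab∈) eq

      vertex : ∀ {p} → p ∈ G N → EvenVertex p → (∀ i → lookup w i ≡ c → p ≢ B N i) → p ∈ V × EvenVertex p
      vertex p∈G even ≢B = (p∈G , (λ i → even≢odd even (A-odd i)) , ≢B , λ i _ → even≢odd even (A′-odd i)) , even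

      sound : ∀ {p} → p ∈ₗ evens c (B N) w → p ∈ V × EvenVertex p
      sound p∈ with ∈-++⁻ (map innerEven (triangle n)) p∈
      ... | inj₁ ∈inner with (a , b) , ab∈ , refl ← ∈-map⁻ innerEven ∈inner =
        vertex (evenPt∈G a b (ℕ.m≤n⇒m≤1+n (∈-triangle⁻ n ab∈))) (evenPt-even a b)
               (λ i _ → inner≢B a b i (∈-triangle⁻ n ab∈))
      ... | inj₂ ∈B with i , i∈ , refl ← ∈-map⁻ (B N) ∈B =
        vertex (B∈G i) (B-even i)
               (λ j wj≡c Bi≡Bj → ∈-kept⁻ c w i∈ (trans (cong (lookup w) (B-injective Bi≡Bj)) wj≡c))

      complete : ∀ {p} → p ∈ V → EvenVertex p → p ∈ₗ evens c (B N) w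
      complete {p} (p∈G , _ , ≢B , _) even with G-coordinates {N} {p} p∈G
      ... | inj₁ (a , b , refl , _) = contradiction (oddPt-odd a b) even
      -- Strict inequality means a row above the bottom one, where no even vertex is deleted;
      -- equality means the bottom row, where the point is `B N i` with `i` equal to `a`.
      ... | inj₂ (a , b , refl , a+b<N) with a + b ℕ.<? n
      ...   | yes a+b<n = ∈-++⁺ˡ (∈-map⁺ innerEven {x = a , b} (∈-triangle⁺ n a+b<n))
      ...   | no  a+b≮n = ∈-++⁺ʳ (map innerEven (triangle n))
                (subst (_∈ₗ map (B N) (kept c w)) (sym eq)
                  (∈-map⁺ (B N) (∈-kept⁺ c w (λ wi≡c → ≢B i wi≡c eq))))
        where
        a+b≡n : a + b ≡ n
        a+b≡n = ℕ.≤-antisym (s≤s⁻¹ a+b<N) (ℕ.≮⇒≥ a+b≮n)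
        a<N : a < N
        a<N = ℕ.≤-<-trans (ℕ.m≤m+n a b) a+b<N
        i : Fin N
        i = fromℕ< a<N
        eq : evenPt a b ≡ B N i
        eq = sym (trans (B-coordinates i) (cong₂ evenPt (Fin.toℕ-fromℕ< a<N)
          (trans (cong₂ _∸_ (sym a+b≡n) (Fin.toℕ-fromℕ< a<N)) (ℕ.m+n∸m≡n a b))))

    enumerate-odds : Enumeration V OddVertex (odds c A′ u)
    enumerate-odds = record { unique = unique ; sound = sound ; complete = complete }
      where
      unique : Unique (odds c A′ u)
      unique = Unique.++⁺ (Unique.map⁺ innerOdd-injective (unique-triangle n))
                          (Unique.map⁺ A′-injective (unique-kept c u)) disjoint
        where
        disjoint : ∀ {p} → p ∈ₗ map innerOdd (triangle n) × p ∈ₗ map A′ (kept c u) → ⊥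
        disjoint (∈inner , ∈A′)
          with ab , _ , refl ← ∈-map⁻ innerOdd ∈inner
          with i , _ , eq ← ∈-map⁻ A′ ∈A′ = inner≢A′ ab i eq

      vertex : ∀ {p} → p ∈ G N → OddVertex p → (∀ i → p ≢ A i) → (∀ i → lookup u i ≡ c → p ≢ A′ i) →
               p ∈ V × OddVertex p
      vertex p∈G odd ≢A ≢A′ = (p∈G , ≢A , (λ i _ → even≢odd (B-even i) odd ∘ sym) , ≢A′) , odd

      sound : ∀ {p} → p ∈ₗ odds c A′ u → p ∈ V × OddVertex p
      sound p∈ with ∈-++⁻ (map innerOdd (triangle n)) p∈
      ... | inj₁ ∈inner with ab@(a , b) , ab∈ , refl ← ∈-map⁻ innerOdd ∈inner =
        vertex (subst (G N) (sym (step-down-even a b)) (oddPt∈G (suc a) (suc b) (s≤s z≤n)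
                 (s≤s (ℕ.≤-trans (ℕ.≤-reflexive (ℕ.+-suc a b)) (∈-triangle⁻ n ab∈)))))
               (subst OddVertex (sym (step-down-even a b)) (oddPt-odd (suc a) (suc b)))
               (inner≢A ab) (λ i _ → inner≢A′ ab i)
      ... | inj₂ ∈A′ with i , i∈ , refl ← ∈-map⁻ A′ ∈A′ =
        vertex (A′∈G i) (A′-odd i) (λ j → A≢A′ j i ∘ sym)
               (λ j uj≡c eq → ∈-kept⁻ c u i∈ (trans (cong (lookup u) (A′-injective eq)) uj≡c))

      complete : ∀ {p} → p ∈ V → OddVertex p → p ∈ₗ odds c A′ u
      complete {p} (p∈G , ≢A , _ , ≢A′) odd with G-coordinates {N} {p} p∈G
      ... | inj₂ (a , b , refl , _) = contradiction odd (evenPt-even a b)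
      ... | inj₁ (a , b , refl , 1≤ , ≤N) with cover a b 1≤ ≤N
      ...   | inj₁ (ab , ab∈ , eq) =
                ∈-++⁺ˡ (subst (_∈ₗ map innerOdd (triangle n)) (sym eq) (∈-map⁺ innerOdd ab∈))
      ...   | inj₂ (inj₁ (i , eq)) = contradiction eq (≢A i)
      ...   | inj₂ (inj₂ (i , eq)) = ∈-++⁺ʳ (map innerOdd (triangle n))
                (subst (_∈ₗ map A′ (kept c u)) (sym eq) (∈-map⁺ A′ (∈-kept⁺ c u (λ ui≡c → ≢A′ i ui≡c eq))))

-- The balance over the colour classes

square≡2tri+n : ∀ n → n * n ≡ tri n + tri n + n
square≡2tri+n 0       = refl
square≡2tri+n (suc n) = trans (lhs n) (trans
  (cong (λ k → k + (n + n + 1)) (square≡2tri+n n)) (rhs n (tri n)))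
  where
  lhs : ∀ n → suc n * suc n ≡ n * n + (n + n + 1)
  lhs = ℕ-Ring.solve-∀
  rhs : ∀ n t → t + t + n + (n + n + 1) ≡ n + t + (n + t) + suc n
  rhs = ℕ-Ring.solve-∀

-- `l` is the sum over the heads, `innerSum` included. It is cancelled as a whole, and then the
-- factor 2.
halve : ∀ {x y l r} → + 2 ℤ.* x ℤ.+ l ≡ r → r ≡ + 2 ℤ.* y ℤ.+ l → x ≡ y
halve {x} {y} {l} eq eq′ =
  ℤ.*-cancelˡ-≡ (+ 2) x y (+ᶻ-cancelʳ l (+ 2 ℤ.* x) (+ 2 ℤ.* y) (trans eq eq′))

module _ {n : ℕ} where

  private
    N = suc n
    T : List (ℕ × ℕ)
    T = triangle n

  innerSum : (Point → ℤ) → ℤ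
  innerSum φ = ∑ (φ ∘ innerEven) T

  ∑-boundary : (φ : Point → ℤ) (A : Fin N → Point) (k c : ℤ) →
    (∀ i → φ (A i) ≡ k ℤ.* + toℕ i ℤ.+ c) →
    ∀ l (u : Word N) → ∑ φ (map A (kept l u)) ≡ k ℤ.* positionSum l u ℤ.+ + length (kept l u) ℤ.* c
  ∑-boundary φ A k c φA l u = trans (∑-map φ A (kept l u))
    (∑-affine {f = λ i → + toℕ i} k c φA (kept l u))

  ∑-evens : (φ : Point → ℤ) (A : Fin N → Point) (k c : ℤ) →
    (∀ i → φ (A i) ≡ k ℤ.* + toℕ i ℤ.+ c) →
    ∀ l (u : Word N) → ∑ φ (evens l A u) ≡
            innerSum φ ℤ.+ (k ℤ.* positionSum l u ℤ.+ + length (kept l u) ℤ.* c)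
  ∑-evens φ A k c φA l u = trans (∑-++ φ (map innerEven T) (map A (kept l u)))
    (cong₂ ℤ._+_ (∑-map φ innerEven T) (∑-boundary φ A k c φA l u))

  -- `s` is the change of `φ` on going down, -1 for `diag` and 1 for `antidiag`; each of the `tri N`
  -- inner vertices contributes it once.
  ∑-odds : (φ : Point → ℤ) (A : Fin N → Point) (k c s : ℤ) →
    (∀ i → φ (A i) ≡ k ℤ.* + toℕ i ℤ.+ c) →
    (∀ p → φ (step down p) ≡ φ p ℤ.+ s) →
    ∀ l (u : Word N) → ∑ φ (odds l A u) ≡
            innerSum φ ℤ.+ + tri N ℤ.* s ℤ.+ (k ℤ.* positionSum l u ℤ.+ + length (kept l u) ℤ.* c)
  ∑-odds φ A k c s φA φ-down l u = trans (∑-++ φ (map innerOdd T) (map A (kept l u)))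
    (cong₂ ℤ._+_ innerPart (∑-boundary φ A k c φA l u))
    where
    innerPart : ∑ φ (map innerOdd T) ≡ innerSum φ ℤ.+ + tri N ℤ.* s
    innerPart = begin
      ∑ φ (map innerOdd T)
        ≡⟨ ∑-map φ innerOdd T ⟩
      ∑ (φ ∘ innerOdd) T
        ≡⟨ ∑-affine {f = φ ∘ innerEven} 1ℤ s
             (λ ab → trans (φ-down (innerEven ab))
                           (cong (λ z → z ℤ.+ s) (sym (ℤ.*-identityˡ (φ (innerEven ab)))))) T ⟩
      1ℤ ℤ.* innerSum φ ℤ.+ + length T ℤ.* s
        ≡⟨ cong₂ (λ z m → z ℤ.+ + m ℤ.* s) (ℤ.*-identityˡ (innerSum φ)) (length-triangle n) ⟩
      innerSum φ ℤ.+ + tri N ℤ.* s ∎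
      where open ≡-Reasoning

  length-inner++ : (f : ℕ × ℕ → Point) (A : Fin N → Point) → ∀ l (u : Word N) →
    length (map f T ++ map A (kept l u)) ≡ tri N + length (kept l u)
  length-inner++ f A l u = trans (length-++ (map f T))
    (cong₂ _+_ (trans (length-map f T) (length-triangle n)) (length-map A (kept l u)))

  diag-B : ∀ i → diag (B N i) ≡ + 2 ℤ.* + toℕ i ℤ.+ (1ℤ - + 2 ℤ.* + N)
  diag-B i = trans (cong (λ z → - + N ℤ.+ (1ℤ ℤ.+ z) ℤ.+ - + N) (ℤ.pos-* 2 (toℕ i))) (lemma (+ N) (+ toℕ i))
    where
    lemma : ∀ m j → - m ℤ.+ (1ℤ ℤ.+ + 2 ℤ.* j) ℤ.+ - m ≡ + 2 ℤ.* j ℤ.+ (1ℤ - + 2 ℤ.* m)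
    lemma = ℤ-Ring.solve-∀

  antidiag-B : ∀ i → antidiag (B N i) ≡ + 2 ℤ.* + toℕ i ℤ.+ 1ℤ
  antidiag-B i = trans (cong (λ z → - + N ℤ.+ (1ℤ ℤ.+ z) - - + N) (ℤ.pos-* 2 (toℕ i))) (lemma (+ N) (+ toℕ i))
    where
    lemma : ∀ m j → - m ℤ.+ (1ℤ ℤ.+ + 2 ℤ.* j) - - m ≡ + 2 ℤ.* j ℤ.+ 1ℤ
    lemma = ℤ-Ring.solve-∀

  diag-L : ∀ i → diag (L N i) ≡ + 2 ℤ.* + toℕ i ℤ.+ - (+ 2 ℤ.* + N)
  diag-L i = trans (cong (λ z → - z ℤ.+ - z) N∸i) (lemma (+ N) (+ toℕ i))
    where
    N∸i : + (N ∸ toℕ i) ≡ + N - + toℕ i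
    N∸i = trans (sym (ℤ.⊖-≥ (ℕ.<⇒≤ (Fin.toℕ<n i)))) (sym (ℤ.m-n≡m⊖n N (toℕ i)))
    lemma : ∀ m j → - (m - j) ℤ.+ - (m - j) ≡ + 2 ℤ.* j ℤ.+ - (+ 2 ℤ.* m)
    lemma = ℤ-Ring.solve-∀

  antidiag-L : ∀ i → antidiag (L N i) ≡ 0ℤ ℤ.* + toℕ i ℤ.+ 0ℤ
  antidiag-L i = lemma (- + (N ∸ toℕ i)) (+ toℕ i)
    where
    lemma : ∀ m j → m - m ≡ 0ℤ ℤ.* j ℤ.+ 0ℤ
    lemma = ℤ-Ring.solve-∀

  diag-R : ∀ i → diag (R N i) ≡ 0ℤ ℤ.* + toℕ i ℤ.+ 0ℤ
  diag-R i = lemma (+ suc (toℕ i)) (+ toℕ i)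
    where
    lemma : ∀ m j → m ℤ.+ - m ≡ 0ℤ ℤ.* j ℤ.+ 0ℤ
    lemma = ℤ-Ring.solve-∀

  antidiag-R : ∀ i → antidiag (R N i) ≡ + 2 ℤ.* + toℕ i ℤ.+ + 2
  antidiag-R i = lemma (+ toℕ i)
    where
    lemma : ∀ j → (1ℤ ℤ.+ j) - - (1ℤ ℤ.+ j) ≡ + 2 ℤ.* j ℤ.+ + 2
    lemma = ℤ-Ring.solve-∀

  -- The three identities for `Gₒ u w`

  module _ (u w : Word N) (N₀ : ℕ) (|u|₀≡N₀ : ∣ u ∣₀ ≡ N₀) (|w|₀≡N₀ : ∣ w ∣₀ ≡ N₀)
           (M : PerfectMatching (Gₒ u w)) where

    private
      N₁ = N ∸ N₀

      tails : Enumeration (Gₒ u w) OddVertex (odds 0F (L N) u)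
      tails = enumerate-odds sides-RL 0F u w

      heads : Enumeration (Gₒ u w) EvenVertex (evens 0F (B N) w)
      heads = enumerate-evens sides-RL 0F u w

      length≡N₁ : ∀ (x : Word N) → ∣ x ∣₀ ≡ N₀ → length (kept 0F x) ≡ N₁
      length≡N₁ x refl = trans (sym (ℕ.m+n∸n≡m (length (kept 0F x)) ∣ x ∣₀))
                               (cong (λ k → k ∸ ∣ x ∣₀) (length-kept-0 x))

      -- The kept letters are the 1s; their positions are what the 0s leave over from 0 + 1 + ... +
      -- (N - 1).
      positions≡ : ∀ (x : Word N) → ∣ x ∣₀ ≡ N₀ → positionSum 0F x ≡ + tri N - + (tri N₀ + d x)
      positions≡ x refl = trans (cancel (positionSum 0F x) (positionSum 1F x))
        (cong₂ (λ a b → a - b) (positionSum-total x) (positionSum-1 x))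
        where
        cancel : ∀ a b → a ≡ a ℤ.+ b - b
        cancel = ℤ-Ring.solve-∀

      length-tails : length (odds 0F (L N) u) ≡ tri N + N₁
      length-tails = trans (length-inner++ _ (L N) 0F u) (cong (λ k → tri N + k) (length≡N₁ u |u|₀≡N₀))

      balance : ∀ φ α β → (∀ δ p → φ (step δ p) ≡ φ p ℤ.+ (1ℤ - + 2 ℤ.* (𝟙 α δ ℤ.+ 𝟙 β δ))) →
        ∀ kB cB → (∀ i → φ (B N i) ≡ kB ℤ.* + toℕ i ℤ.+ cB) →
        ∀ kL cL → (∀ i → φ (L N i) ≡ kL ℤ.* + toℕ i ℤ.+ cL) →
        + 2 ℤ.* + (numberPointing oddVertex? α M + numberPointing oddVertex? β M)
          ℤ.+ (innerSum φ ℤ.+ (kB ℤ.* positionSum 0F w ℤ.+ + N₁ ℤ.* cB)) ≡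
        + (tri N + N₁) ℤ.+ (innerSum φ ℤ.+ + tri N ℤ.* (1ℤ - + 2 ℤ.* (𝟙 α down ℤ.+ 𝟙 β down))
                            ℤ.+ (kL ℤ.* positionSum 0F u ℤ.+ + N₁ ℤ.* cL))
      balance φ α β φ-step kB cB φB kL cL φL = begin
        + 2 ℤ.* X ℤ.+ evenSum (+ N₁)
          ≡⟨ cong (λ k → + 2 ℤ.* X ℤ.+ evenSum (+ k)) (length≡N₁ w |w|₀≡N₀) ⟨
        + 2 ℤ.* X ℤ.+ evenSum (+ length (kept 0F w))
          ≡⟨ cong (λ z → + 2 ℤ.* X ℤ.+ z) (∑-evens φ (B N) kB cB φB 0F w) ⟨
        + 2 ℤ.* X ℤ.+ ∑ φ (evens 0F (B N) w)
          ≡⟨ numberPointing-pair oddVertex? odd-bipartite M tails heads φ α β φ-step ⟩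
        + length (odds 0F (L N) u) ℤ.+ ∑ φ (odds 0F (L N) u)
          ≡⟨ cong₂ (λ k z → + k ℤ.+ z) length-tails (∑-odds φ (L N) kL cL _ φL (φ-step down) 0F u) ⟩
        + (tri N + N₁) ℤ.+ oddSum (+ length (kept 0F u))
          ≡⟨ cong (λ k → + (tri N + N₁) ℤ.+ oddSum (+ k)) (length≡N₁ u |u|₀≡N₀) ⟩
        + (tri N + N₁) ℤ.+ oddSum (+ N₁) ∎
        where
        open ≡-Reasoning
        X = + (numberPointing oddVertex? α M + numberPointing oddVertex? β M)
        evenSum oddSum : ℤ → ℤ
        evenSum k = innerSum φ ℤ.+ (kB ℤ.* positionSum 0F w ℤ.+ k ℤ.* cB)
        oddSum k = innerSum φ ℤ.+ + tri N ℤ.* (1ℤ - + 2 ℤ.* (𝟙 α down ℤ.+ 𝟙 β down))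
                   ℤ.+ (kL ℤ.* positionSum 0F u ℤ.+ k ℤ.* cL)

    odd-total : oU M + oD M + oR M + oL M ≡ tri N + N₁
    odd-total = trans (numberPointing-total oddVertex? odd-bipartite M tails heads) length-tails

    odd-left-down : + (oL M + oD M) ≡ + d w - + d u
    odd-left-down = begin
      + (oL M + oD M)
        -- Going down costs 1 per inner vertex, which absorbs the `tri N` inner tails. The remaining
        -- `N₁` tails are absorbed by the offsets of `diag`, which differ by 1 between `B` and `L`.
        ≡⟨ halve (balance diag left down diag-step (+ 2) (1ℤ - + 2 ℤ.* + N) diag-B (+ 2) (- (+ 2 ℤ.* + N)) diag-L)
             (rearrange (innerSum diag) (positionSum 0F u) (positionSum 0F w) (+ tri N) (+ N₁) (+ N)) ⟩
      positionSum 0F u - positionSum 0F w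
        ≡⟨ cong₂ (λ a b → a - b) (positions≡ u |u|₀≡N₀) (positions≡ w |w|₀≡N₀) ⟩
      (+ tri N - (+ tri N₀ ℤ.+ + d u)) - (+ tri N - (+ tri N₀ ℤ.+ + d w))
        ≡⟨ cancel (+ tri N) (+ tri N₀) (+ d u) (+ d w) ⟩
      + d w - + d u ∎
      where
      open ≡-Reasoning
      rearrange : ∀ s a b t k m →
        t ℤ.+ k ℤ.+ (s ℤ.+ t ℤ.* -1ℤ ℤ.+ (+ 2 ℤ.* a ℤ.+ k ℤ.* - (+ 2 ℤ.* m))) ≡
        + 2 ℤ.* (a - b) ℤ.+ (s ℤ.+ (+ 2 ℤ.* b ℤ.+ k ℤ.* (1ℤ - + 2 ℤ.* m)))
      rearrange = ℤ-Ring.solve-∀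
      cancel : ∀ t s a b → (t - (s ℤ.+ a)) - (t - (s ℤ.+ b)) ≡ b - a
      cancel = ℤ-Ring.solve-∀

    odd-up-left : oU M + oL M ≡ tri N₀ + d w
    odd-up-left = ℤ.+-injective (begin
      + (oU M + oL M)
        ≡⟨ halve (balance antidiag up left antidiag-step (+ 2) 1ℤ antidiag-B 0ℤ 0ℤ antidiag-L)
             (rearrange (innerSum antidiag) (positionSum 0F u) (positionSum 0F w) (+ tri N) (+ N₁)) ⟩
      -- Here going down adds 1, so `tri N` is doubled instead of cancelled and survives the
      -- halving. The difference is the sum of the positions of the 0s of `w`.
      + tri N - positionSum 0F w
        ≡⟨ cong (λ a → + tri N - a) (positions≡ w |w|₀≡N₀) ⟩
      + tri N - (+ tri N - + (tri N₀ + d w))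
        ≡⟨ cancel (+ tri N) (+ (tri N₀ + d w)) ⟩
      + (tri N₀ + d w) ∎)
      where
      open ≡-Reasoning
      rearrange : ∀ s a b t k →
        t ℤ.+ k ℤ.+ (s ℤ.+ t ℤ.* 1ℤ ℤ.+ (0ℤ ℤ.* a ℤ.+ k ℤ.* 0ℤ)) ≡
        + 2 ℤ.* (t - b) ℤ.+ (s ℤ.+ (+ 2 ℤ.* b ℤ.+ k ℤ.* 1ℤ))
      rearrange = ℤ-Ring.solve-∀
      cancel : ∀ t a → t - (t - a) ≡ a
      cancel = ℤ-Ring.solve-∀

  -- The three identities for `Gₑ v w`

  module _ (v w : Word N) (N₀ : ℕ) (|v|₀≡N₀ : ∣ v ∣₀ ≡ N₀) (|w|₀≡N₀ : ∣ w ∣₀ ≡ N₀)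
           (M : PerfectMatching (Gₑ v w)) where

    private
      N₁ = N ∸ N₀

      tails : Enumeration (Gₑ v w) EvenVertex (evens 1F (B N) w)
      tails = enumerate-evens sides-LR 1F v w

      -- The heads are given as not even, a double negation of odd, which decidability of the parity
      -- removes.
      heads : Enumeration (Gₑ v w) (¬_ ∘ EvenVertex) (odds 1F (R N) v)
      heads = record
        { unique   = E.unique
        ; sound    = λ p∈ → let (p∈V , odd) = E.sound p∈ in p∈V , λ even → even odd
        ; complete = λ {p} p∈V ¬even → E.complete p∈V (decidable-stable (oddVertex? p) ¬even)
        }
        where module E = Enumeration (enumerate-odds sides-LR 1F v w)

      length≡N₀ : ∀ (x : Word N) → ∣ x ∣₀ ≡ N₀ → length (kept 1F x) ≡ N₀
      length≡N₀ x refl = length-kept-1 x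

      positions≡ : ∀ (x : Word N) → ∣ x ∣₀ ≡ N₀ → positionSum 1F x ≡ + (tri N₀ + d x)
      positions≡ x refl = positionSum-1 x

      length-tails : length (evens 1F (B N) w) ≡ tri N + N₀
      length-tails = trans (length-inner++ _ (B N) 1F w) (cong (λ k → tri N + k) (length≡N₀ w |w|₀≡N₀))

      balance : ∀ φ α β → (∀ δ p → φ (step δ p) ≡ φ p ℤ.+ (1ℤ - + 2 ℤ.* (𝟙 α δ ℤ.+ 𝟙 β δ))) →
        ∀ kB cB → (∀ i → φ (B N i) ≡ kB ℤ.* + toℕ i ℤ.+ cB) →
        ∀ kR cR → (∀ i → φ (R N i) ≡ kR ℤ.* + toℕ i ℤ.+ cR) →
        + 2 ℤ.* + (numberPointing evenVertex? α M + numberPointing evenVertex? β M)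
          ℤ.+ (innerSum φ ℤ.+ + tri N ℤ.* (1ℤ - + 2 ℤ.* (𝟙 α down ℤ.+ 𝟙 β down))
               ℤ.+ (kR ℤ.* positionSum 1F v ℤ.+ + N₀ ℤ.* cR)) ≡
        + (tri N + N₀) ℤ.+ (innerSum φ ℤ.+ (kB ℤ.* positionSum 1F w ℤ.+ + N₀ ℤ.* cB))
      balance φ α β φ-step kB cB φB kR cR φR = begin
        + 2 ℤ.* X ℤ.+ oddSum (+ N₀)
          ≡⟨ cong (λ k → + 2 ℤ.* X ℤ.+ oddSum (+ k)) (length≡N₀ v |v|₀≡N₀) ⟨
        + 2 ℤ.* X ℤ.+ oddSum (+ length (kept 1F v))
          ≡⟨ cong (λ z → + 2 ℤ.* X ℤ.+ z) (∑-odds φ (R N) kR cR _ φR (φ-step down) 1F v) ⟨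
        + 2 ℤ.* X ℤ.+ ∑ φ (odds 1F (R N) v)
          ≡⟨ numberPointing-pair evenVertex? even-bipartite M tails heads φ α β φ-step ⟩
        + length (evens 1F (B N) w) ℤ.+ ∑ φ (evens 1F (B N) w)
          ≡⟨ cong₂ (λ k z → + k ℤ.+ z) length-tails (∑-evens φ (B N) kB cB φB 1F w) ⟩
        + (tri N + N₀) ℤ.+ evenSum (+ length (kept 1F w))
          ≡⟨ cong (λ k → + (tri N + N₀) ℤ.+ evenSum (+ k)) (length≡N₀ w |w|₀≡N₀) ⟩
        + (tri N + N₀) ℤ.+ evenSum (+ N₀) ∎
        where
        open ≡-Reasoning
        X = + (numberPointing evenVertex? α M + numberPointing evenVertex? β M)
        evenSum oddSum : ℤ → ℤ
        evenSum k = innerSum φ ℤ.+ (kB ℤ.* positionSum 1F w ℤ.+ k ℤ.* cB)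
        oddSum k = innerSum φ ℤ.+ + tri N ℤ.* (1ℤ - + 2 ℤ.* (𝟙 α down ℤ.+ 𝟙 β down))
                   ℤ.+ (kR ℤ.* positionSum 1F v ℤ.+ k ℤ.* cR)

    even-total : eU M + eD M + eR M + eL M ≡ tri N + N₀
    even-total = trans (numberPointing-total evenVertex? even-bipartite M tails heads) length-tails

    even-left-up : + (eL M + eU M) ≡ + d w - + d v
    even-left-up = begin
      + (eL M + eU M)
        ≡⟨ cong +_ (ℕ.+-comm (eL M) (eU M)) ⟩
      + (eU M + eL M)
        -- The shift of the inner heads now cancels the `tri N` inner tails, and the offsets 1 on
        -- `B` and 2 on `R` cancel the remaining `N₀` tails.
        ≡⟨ halve (balance antidiag up left antidiag-step (+ 2) 1ℤ antidiag-B (+ 2) (+ 2) antidiag-R)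
             (rearrange (innerSum antidiag) (positionSum 1F v) (positionSum 1F w) (+ tri N) (+ N₀)) ⟩
      positionSum 1F w - positionSum 1F v
        ≡⟨ cong₂ (λ a b → a - b) (positions≡ w |w|₀≡N₀) (positions≡ v |v|₀≡N₀) ⟩
      (+ tri N₀ ℤ.+ + d w) - (+ tri N₀ ℤ.+ + d v)
        ≡⟨ cancel (+ tri N₀) (+ d w) (+ d v) ⟩
      + d w - + d v ∎
      where
      open ≡-Reasoning
      rearrange : ∀ s a b t k →
        t ℤ.+ k ℤ.+ (s ℤ.+ (+ 2 ℤ.* b ℤ.+ k ℤ.* 1ℤ)) ≡
        + 2 ℤ.* (b - a) ℤ.+ (s ℤ.+ t ℤ.* 1ℤ ℤ.+ (+ 2 ℤ.* a ℤ.+ k ℤ.* + 2))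
      rearrange = ℤ-Ring.solve-∀
      cancel : ∀ s a b → (s ℤ.+ a) - (s ℤ.+ b) ≡ a - b
      cancel = ℤ-Ring.solve-∀

    -- `diag` vanishes on `R`, and its offset 1 - 2N on `B` leaves the product N₀ N. Once `tri N` is
    -- split along N = N₁ + N₀, the mixed products N₁ N₀ cancel, and so do the terms in N₀ alone,
    -- because N₀ squared is 2 `tri N₀` + N₀.
    even-down-left : eD M + eL M ≡ tri N₁ + d w
    even-down-left = ℤ.+-injective (begin
      + (eD M + eL M)
        ≡⟨ cong +_ (ℕ.+-comm (eD M) (eL M)) ⟩
      + (eL M + eD M)
        ≡⟨ halve (balance diag left down diag-step (+ 2) (1ℤ - + 2 ℤ.* + N) diag-B 0ℤ 0ℤ diag-R)
             (rearrange (innerSum diag) (positionSum 1F v) (positionSum 1F w) (+ tri N) (+ N₀) (+ N)) ⟩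
      + tri N ℤ.+ + N₀ ℤ.+ positionSum 1F w - + N₀ ℤ.* + N
        ≡⟨ cong₂ (λ t s → t ℤ.+ + N₀ ℤ.+ s - + N₀ ℤ.* + N) triN (positions≡ w |w|₀≡N₀) ⟩
      + tri N₁ ℤ.+ + tri N₀ ℤ.+ + N₁ ℤ.* + N₀ ℤ.+ + N₀ ℤ.+ (+ tri N₀ ℤ.+ + d w) - + N₀ ℤ.* + N
        ≡⟨ cong (λ m → + tri N₁ ℤ.+ + tri N₀ ℤ.+ + N₁ ℤ.* + N₀ ℤ.+ + N₀ ℤ.+ (+ tri N₀ ℤ.+ + d w) - + N₀ ℤ.* + m)
             (sym N₁+N₀≡N) ⟩
      + tri N₁ ℤ.+ + tri N₀ ℤ.+ + N₁ ℤ.* + N₀ ℤ.+ + N₀ ℤ.+ (+ tri N₀ ℤ.+ + d w) - + N₀ ℤ.* (+ N₁ ℤ.+ + N₀)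
        ≡⟨ regroup (+ tri N₁) (+ tri N₀) (+ N₁) (+ N₀) (+ d w) ⟩
      + (tri N₁ + d w) ℤ.+ (+ (tri N₀ + tri N₀ + N₀) - + N₀ ℤ.* + N₀)
        ≡⟨ cong (λ z → + (tri N₁ + d w) ℤ.+ (+ (tri N₀ + tri N₀ + N₀) - z))
             (trans (sym (ℤ.pos-* N₀ N₀)) (cong +_ (square≡2tri+n N₀))) ⟩
      + (tri N₁ + d w) ℤ.+ (+ (tri N₀ + tri N₀ + N₀) - + (tri N₀ + tri N₀ + N₀))
        ≡⟨ cong (λ z → + (tri N₁ + d w) ℤ.+ z) (ℤ.+-inverseʳ (+ (tri N₀ + tri N₀ + N₀))) ⟩
      + (tri N₁ + d w) ℤ.+ 0ℤ
        ≡⟨ ℤ.+-identityʳ _ ⟩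
      + (tri N₁ + d w) ∎)
      where
      open ≡-Reasoning
      N₀≤N : N₀ ≤ N
      N₀≤N = subst (_≤ N) |w|₀≡N₀ (subst (∣ w ∣₀ ≤_) (length-kept-0 w) (ℕ.m≤n+m ∣ w ∣₀ (length (kept 0F w))))
      N₁+N₀≡N : N₁ + N₀ ≡ N
      N₁+N₀≡N = ℕ.m∸n+n≡m N₀≤N
      triN : + tri N ≡ + tri N₁ ℤ.+ + tri N₀ ℤ.+ + N₁ ℤ.* + N₀
      triN = trans (cong (λ m → + tri m) (sym N₁+N₀≡N)) (trans (cong +_ (tri-+ N₁ N₀))
        (cong (λ z → + tri N₁ ℤ.+ + tri N₀ ℤ.+ z) (ℤ.pos-* N₁ N₀)))
      rearrange : ∀ s a b t k m →
        t ℤ.+ k ℤ.+ (s ℤ.+ (+ 2 ℤ.* b ℤ.+ k ℤ.* (1ℤ - + 2 ℤ.* m))) ≡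
        + 2 ℤ.* (t ℤ.+ k ℤ.+ b - k ℤ.* m) ℤ.+ (s ℤ.+ t ℤ.* -1ℤ ℤ.+ (0ℤ ℤ.* a ℤ.+ k ℤ.* 0ℤ))
      rearrange = ℤ-Ring.solve-∀
      regroup : ∀ t₁ t₀ n₁ n₀ e →
        t₁ ℤ.+ t₀ ℤ.+ n₁ ℤ.* n₀ ℤ.+ n₀ ℤ.+ (t₀ ℤ.+ e) - n₀ ℤ.* (n₁ ℤ.+ n₀) ≡
        t₁ ℤ.+ e ℤ.+ (t₀ ℤ.+ t₀ ℤ.+ n₀ - n₀ ℤ.* n₀)
      regroup = ℤ-Ring.solve-∀

theorem3p5 : ∀ (N : ℕ) → 1 ≤ N → (u v w : Word N) (N₀ : ℕ) →
    ∣ u ∣₀ ≡ N₀ → ∣ v ∣₀ ≡ N₀ → ∣ w ∣₀ ≡ N₀ →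
    let N₁ = N ∸ N₀ in
    ((M : PerfectMatching (Gₒ u w)) →
    (oU M + oD M + oR M + oL M ≡ N * (N ∸ 1) / 2 + N₁)
    × (+ (oL M + oD M) ≡ + d w - + d u)
    × (oU M + oL M ≡ N₀ * (N₀ ∸ 1) / 2 + d w))
    ×
    ((M : PerfectMatching (Gₑ v w)) →
    (eU M + eD M + eR M + eL M ≡ N * (N ∸ 1) / 2 + N₀)
    × (+ (eL M + eU M) ≡ + d w - + d v)
    × (eD M + eL M ≡ N₁ * (N₁ ∸ 1) / 2 + d w))
-- The pattern exposes the predecessor n of N, the size of the triangle of inner vertices.
theorem3p5 N@(suc _) _ u v w N₀ hu hv hw =
    (λ M → trans (odd-total u w N₀ hu hw M) (cong (λ t → t + (N ∸ N₀)) (tri≡n*[n∸1]/2 N))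
         , odd-left-down u w N₀ hu hw M
         , trans (odd-up-left u w N₀ hu hw M) (cong (λ t → t + d w) (tri≡n*[n∸1]/2 N₀)))
  , (λ M → trans (even-total v w N₀ hv hw M) (cong (λ t → t + N₀) (tri≡n*[n∸1]/2 N))
         , even-left-up v w N₀ hv hw M
         , trans (even-down-left v w N₀ hv hw M) (cong (λ t → t + d w) (tri≡n*[n∸1]/2 (N ∸ N₀))))
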